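{- Restricted to instances with $r=0$ (all arcs have weight $1$), the problem Effectors is in $\mathsf{XP}$ with respect to each of the following three parameters separately: the number $a=|A|$ of target nodes, the budget $b$, and the cost $c$.
   Context: An influence graph $G=(V,E,w)$ is a finite simple directed graph (no loops) with a weight function $w:E\to(0,1]\cap\mathbb{Q}$; $r:=|\{u\to v\in E: w(u\to v)<1\}|$ is the number of probabilistic arcs. Independent Cascade process started from $X\subseteq V$: at time $0$ exactly the nodes in $X$ are active. When a node $u$ becomes active for the first time, at time step $t$, it gets a single chance to activate each currently inactive out-neighbor $v$, succeeding with probability $w(u\to v)$, all attempts being independent; if it succeeds, $v$ becomes active at step $t+1$; if it fails, $u$ makes no further attempts on $v$. Active nodes stay active. The process terminates when there are no newly activated nodes. Let $p(v|X)$ be the probability that $v$ is active upon termination. (If $r=0$, then $p(v|X)=1$ if $v$ is reachable by a directed path from $X$, and $p(v|X)=0$ otherwise.) Cost: for $A\subseteq V$ and $X\subseteq V$, $C_A(G,X):=\sum_{v\in A}(1-p(v|X))+\sum_{v\in V\setminus A}p(v|X)$. Effectors: given an influence graph $G=(V,E,w)$, a set of target nodes $A\subseteq V$, a budget $b\in\mathbb{N}$ and a cost $c\in\mathbb{Q}$, decide whether there is a set $X\subseteq V$ (of effectors) with $|X|\le b$ and $C_A(G,X)\le c$. When $r=0$ all costs $C_A(G,X)$ are nonnegative integers, so $c$ is taken to be a nonnegative integer when it serves as parameter. A parameterized problem with instances $(I,k)$ is in $\mathsf{XP}$ if it can be solved in $|I|^{f(k)}$ time for some computable function $f$. -}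

module Defs where

open import Algebra.Properties.CommutativeMonoid.Sum using (sum)
open import Data.Bool using (Bool; true; false; if_then_else_)
open import Data.Fin using (Fin)
open import Data.Fin.Subset using (Subset; _∈_; _∪_; ∁; ⁅_⁆; ∣_∣) renaming (⊥ to ∅)
open import Data.Fin.Subset.Properties using (_∈?_)
open import Data.Integer as ℤ using (ℤ; +_; -[1+_])
open import Data.List using (List; []; _∷_; length; map; filter; concatMap; mapMaybe; foldr; allFin; cartesianProduct)
open import Data.Maybe using (Maybe; nothing; just)
import Data.Maybe as Maybe
open import Data.Nat using (ℕ; zero; suc; _+_; _^_; _≤_)
open import Data.Nat.Binary using (ℕᵇ; 2[1+_]; 1+[2_]; fromℕ)
open import Data.Product using (Σ; Σ-syntax; ∃-syntax; _×_; _,_; proj₁; proj₂)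
open import Data.Rational as ℚ using (ℚ; 0ℚ; 1ℚ)
import Data.Rational.Properties as ℚ
open import Data.Vec using (Vec; []; _∷_; lookup; toList)
open import Function using (_∘_)
open import Relation.Binary.PropositionalEquality using (_≡_)
open import Relation.Nullary using (Dec; does; ¬?)
open import Relation.Nullary.Decidable using (_×-dec_)
open import Relation.Unary using (Decidable)

------------------------------------------------------------------------
-- Influence graphs

-- The vertex set is Fin order; weight u v ≡ nothing means that there is
-- no arc from u to v.
record InfluenceGraph : Set where
  field
    order    : ℕ
    weight   : Fin order → Fin order → Maybe ℚ
    loopless : ∀ v → weight v v ≡ nothing
    range    : ∀ {u v q} → weight u v ≡ just q → 0ℚ ℚ.< q × q ℚ.≤ 1ℚ

  V : Set
  V = Fin order

  arcs : List (V × V × ℚ)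
  arcs = mapMaybe (λ (u , v) → Maybe.map (λ q → u , v , q) (weight u v))
                  (cartesianProduct (allFin order) (allFin order))

  #probabilistic : ℕ
  #probabilistic = length (filter (λ (_ , _ , q) → q ℚ.<? 1ℚ) arcs)

------------------------------------------------------------------------
-- Finite probability distributions

Dist : Set → Set
Dist A = List (ℚ × A)

return : ∀ {A} → A → Dist A
return x = (1ℚ , x) ∷ []

infixl 1 _>>=_
_>>=_ : ∀ {A B} → Dist A → (A → Dist B) → Dist B
d >>= k = concatMap (λ (p , x) → map (λ (q , y) → p ℚ.* q , y) (k x)) d

bernoulli : ℚ → Dist Bool
bernoulli q = (q , true) ∷ (1ℚ ℚ.- q , false) ∷ []

Pr : ∀ {A} {P : A → Set} → Decidable P → Dist A → ℚ
Pr P? d = foldr ℚ._+_ 0ℚ (map proj₁ (filter (P? ∘ proj₂) d))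

------------------------------------------------------------------------
-- Independent Cascade

module Cascade (G : InfluenceGraph) where
  open InfluenceGraph G

  record State : Set where
    constructor ⟨_,_⟩
    field
      active new : Subset order

  -- The arcs along which an activation is attempted in this time step.
  attempts : State → List (V × V × ℚ)
  attempts ⟨ S , N ⟩ = filter (λ (u , v , _) → u ∈? N ×-dec ¬? (v ∈? S)) arcs

  -- Independent attempts along the given arcs; the result is the set of
  -- heads of the successful ones.
  try : List (V × V × ℚ) → Dist (Subset order)
  try []                 = return ∅
  try ((_ , v , q) ∷ as) =
    bernoulli q >>= λ success →
    try as      >>= λ N →
    return (if success then ⁅ v ⁆ ∪ N else N)

  step : State → Dist State
  step s@(⟨ S , N ⟩) = try (attempts s) >>= λ N′ → return ⟨ S ∪ N′ , N′ ⟩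

  run : ℕ → State → Dist State
  run zero    s = return s
  run (suc k) s = step s >>= run k

  -- The sets of newly activated nodes at different times are disjoint, so
  -- the process has terminated after at most |V| steps; steps taken after
  -- termination do not change the set of active nodes.
  final : Subset order → Dist State
  final X = run order ⟨ X , X ⟩

  p[_∣_] : V → Subset order → ℚ
  p[ v ∣ X ] = Pr (λ s → v ∈? State.active s) (final X)

  ∑∈ : Subset order → (V → ℚ) → ℚ
  ∑∈ S f = sum ℚ.+-0-commutativeMonoid (λ v → if lookup S v then f v else 0ℚ)

  cost : Subset order → Subset order → ℚ
  cost A X = ∑∈ A (λ v → 1ℚ ℚ.- p[ v ∣ X ]) ℚ.+ ∑∈ (∁ A) (λ v → p[ v ∣ X ])

------------------------------------------------------------------------
-- Effectors

record Instance : Set where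
  field
    graph   : InfluenceGraph
    targets : Subset (InfluenceGraph.order graph)
    budget  : ℕ
    bound   : ℚ

Effectors : Instance → Set
Effectors I = Σ[ X ∈ Subset order ] ∣ X ∣ ≤ budget × cost targets X ℚ.≤ bound
  where
  open Instance I
  open InfluenceGraph graph using (order)
  open Cascade graph using (cost)

------------------------------------------------------------------------
-- Model of computation: first-order recursive functions on binary trees
-- (a first-order LISP), where every evaluation rule costs one unit of
-- time.  With trees shared in memory each rule is a constant number of
-- pointer operations, so that up to polynomial factors this is the time
-- of a Turing machine (cf. N. D. Jones, Computability and Complexity,
-- MIT Press 1997, on the languages WHILE and F).

infixr 5 _∙_

data Tree : Set where
  nil : Tree
  _∙_ : Tree → Tree → Tree

size : Tree → ℕ
size nil     = 1
size (s ∙ t) = suc (size s + size t)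

-- Expressions with n free variables (de Bruijn) over m function symbols.
data Exp {m} (arity : Fin m → ℕ) (n : ℕ) : Set where
  var  : Fin n → Exp arity n
  nil  : Exp arity n
  cons : Exp arity n → Exp arity n → Exp arity n
  let′ : Exp arity n → Exp arity (suc n) → Exp arity n
  -- case e e₁ e₂: if e is nil then e₁, otherwise e₂ with variables 0 and
  -- 1 bound to the left and right subtree.
  case : Exp arity n → Exp arity n → Exp arity (suc (suc n)) → Exp arity n
  call : (f : Fin m) → Vec (Exp arity n) (arity f) → Exp arity n

record Program : Set where
  field
    #functions : ℕ
    arity      : Fin #functions → ℕ
    body       : (f : Fin #functions) → Exp arity (arity f)
    main       : Exp arity 1

module Semantics (P : Program) where
  open Program P

  infix 4 _⊢_⇓_⟨_⟩ _⊢*_⇓_⟨_⟩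

  mutual
    -- ρ ⊢ e ⇓ v ⟨ t ⟩: in environment ρ, e evaluates to v in time t.
    data _⊢_⇓_⟨_⟩ {n} (ρ : Vec Tree n) : Exp arity n → Tree → ℕ → Set where
      var : ∀ i → ρ ⊢ var i ⇓ lookup ρ i ⟨ 1 ⟩
      nil : ρ ⊢ nil ⇓ nil ⟨ 1 ⟩
      cons : ∀ {e₁ e₂ v₁ v₂ t₁ t₂} →
        ρ ⊢ e₁ ⇓ v₁ ⟨ t₁ ⟩ → ρ ⊢ e₂ ⇓ v₂ ⟨ t₂ ⟩ →
        ρ ⊢ cons e₁ e₂ ⇓ v₁ ∙ v₂ ⟨ suc (t₁ + t₂) ⟩
      let′ : ∀ {e₁ e₂ v₁ v₂ t₁ t₂} →
        ρ ⊢ e₁ ⇓ v₁ ⟨ t₁ ⟩ → v₁ ∷ ρ ⊢ e₂ ⇓ v₂ ⟨ t₂ ⟩ →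
        ρ ⊢ let′ e₁ e₂ ⇓ v₂ ⟨ suc (t₁ + t₂) ⟩
      case-nil : ∀ {e e₁ e₂ v t t₁} →
        ρ ⊢ e ⇓ nil ⟨ t ⟩ → ρ ⊢ e₁ ⇓ v ⟨ t₁ ⟩ →
        ρ ⊢ case e e₁ e₂ ⇓ v ⟨ suc (t + t₁) ⟩
      case-∙ : ∀ {e e₁ e₂ l r v t t₂} →
        ρ ⊢ e ⇓ l ∙ r ⟨ t ⟩ → l ∷ r ∷ ρ ⊢ e₂ ⇓ v ⟨ t₂ ⟩ →
        ρ ⊢ case e e₁ e₂ ⇓ v ⟨ suc (t + t₂) ⟩
      call : ∀ {f es vs v t₁ t₂} →
        ρ ⊢* es ⇓ vs ⟨ t₁ ⟩ → vs ⊢ body f ⇓ v ⟨ t₂ ⟩ →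
        ρ ⊢ call f es ⇓ v ⟨ suc (t₁ + t₂) ⟩

    data _⊢*_⇓_⟨_⟩ {n} (ρ : Vec Tree n) : ∀ {k} → Vec (Exp arity n) k → Vec Tree k → ℕ → Set where
      []  : ρ ⊢* [] ⇓ [] ⟨ 0 ⟩
      _∷_ : ∀ {k e v t₁ t₂} {es : Vec _ k} {vs} →
        ρ ⊢ e ⇓ v ⟨ t₁ ⟩ → ρ ⊢* es ⇓ vs ⟨ t₂ ⟩ →
        ρ ⊢* e ∷ es ⇓ v ∷ vs ⟨ t₁ + t₂ ⟩

_[_]⇓_⟨_⟩ : Program → Tree → Tree → ℕ → Set
P [ x ]⇓ y ⟨ t ⟩ = (x ∷ []) ⊢ Program.main P ⇓ y ⟨ t ⟩
  where open Semantics P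

------------------------------------------------------------------------
-- Encoding of instances; numbers are in binary.

encBool : Bool → Tree
encBool false = nil
encBool true  = nil ∙ nil

encMaybe : ∀ {A : Set} → (A → Tree) → Maybe A → Tree
encMaybe enc nothing  = nil
encMaybe enc (just x) = nil ∙ enc x

encList : ∀ {A : Set} → (A → Tree) → List A → Tree
encList enc = foldr (λ x t → enc x ∙ t) nil

encℕᵇ : ℕᵇ → Tree
encℕᵇ ℕᵇ.zero  = nil
encℕᵇ 2[1+ n ] = encBool false ∙ encℕᵇ n
encℕᵇ 1+[2 n ] = encBool true ∙ encℕᵇ n

encℕ : ℕ → Tree
encℕ = encℕᵇ ∘ fromℕ

encℤ : ℤ → Tree
encℤ (+ n)    = encBool false ∙ encℕ n
encℤ -[1+ n ] = encBool true ∙ encℕ (suc n)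

encℚ : ℚ → Tree
encℚ q = encℤ (ℚ.↥ q) ∙ encℕ (ℚ.↧ₙ q)

encSubset : ∀ {n} → Subset n → Tree
encSubset = encList encBool ∘ toList

-- The weighted adjacency matrix, row by row.
encGraph : InfluenceGraph → Tree
encGraph G = encList (λ u → encList (λ v → encMaybe encℚ (weight u v)) (allFin order)) (allFin order)
  where open InfluenceGraph G

encInstance : Instance → Tree
encInstance I = encGraph graph ∙ encSubset targets ∙ encℕ budget ∙ encℚ bound
  where open Instance I

------------------------------------------------------------------------
-- Parameterized problems and XP

record ParameterizedProblem : Set₁ where
  field
    Input     : Set
    encode    : Input → Tree
    parameter : Input → ℕ
    Yes       : Input → Set

Computable : (ℕ → ℕ) → Set
Computable f = Σ[ P ∈ Program ] ∀ k → ∃[ t ] P [ encℕ k ]⇓ encℕ (f k) ⟨ t ⟩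

XP : ParameterizedProblem → Set
XP Π =
  Σ[ P ∈ Program ] Σ[ f ∈ (ℕ → ℕ) ] Computable f ×
    (∀ x → Σ[ yes? ∈ Dec (Yes x) ] ∃[ t ]
      t ≤ size (encode x) ^ f (parameter x) ×
      P [ encode x ∙ encℕ (parameter x) ]⇓ encBool (does yes?) ⟨ t ⟩)
  where open ParameterizedProblem Π

------------------------------------------------------------------------
-- Effectors restricted to instances without probabilistic arcs

Deterministic : Instance → Set
Deterministic I = InfluenceGraph.#probabilistic (Instance.graph I) ≡ 0

Effectors-by-targets : ParameterizedProblem
Effectors-by-targets = record
  { Input     = Σ Instance Deterministic
  ; encode    = encInstance ∘ proj₁
  ; parameter = ∣_∣ ∘ Instance.targets ∘ proj₁
  ; Yes       = Effectors ∘ proj₁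
  }

Effectors-by-budget : ParameterizedProblem
Effectors-by-budget = record
  { Input     = Σ Instance Deterministic
  ; encode    = encInstance ∘ proj₁
  ; parameter = Instance.budget ∘ proj₁
  ; Yes       = Effectors ∘ proj₁
  }

-- To serve as a parameter, the cost bound has to be a natural number.
Effectors-by-cost : ParameterizedProblem
Effectors-by-cost = record
  { Input     = Σ[ I ∈ Instance ] Deterministic I × Σ[ c ∈ ℕ ] Instance.bound I ≡ + c ℚ./ 1
  ; encode    = encInstance ∘ proj₁
  ; parameter = λ (_ , _ , c , _) → c
  ; Yes       = Effectors ∘ proj₁
  }

{-# OPTIONS --safe #-}

-- Without probabilistic arcs the cascade activates exactly the closure cl X
-- of X under reachability, so the cost of X is |A △ cl X|.  One program serves
-- all three parameters k: it runs through all sets D of at most k vertices and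
-- tests as effectors both D and an irredundant generating set of A △ D.
-- For the budget D = X works.  For the number of targets, keeping one effector
-- of X for each activated target is enough.  For the cost, D = A △ cl X has at
-- most k elements and A △ D = cl X; an irredundant generating set of a closed
-- set has one vertex in each source component, hence has minimum size.
-- The search visits at most (n + 1)^(k + 1) nodes, each in polynomial time.

module Submission where

open import Defs
open import Data.Bool using (Bool; true; false; T; not; _∨_; _xor_; if_then_else_)
open import Data.Bool.Properties using (T?; T-≡)
open import Data.Empty using (⊥; ⊥-elim)
open import Data.Fin as Fin using (Fin; zero; suc; toℕ)
import Data.Fin.Properties as Fin
open import Data.Fin.Subset using (Subset; _∈_; _∉_; _⊆_; _∪_; _∩_; _-_; ∁; ⁅_⁆; ∣_∣) renaming (⊥ to ∅)
open import Data.Fin.Subset.Properties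
open import Data.Integer as ℤ using (ℤ; +_; -[1+_])
import Data.Integer.Properties as ℤ
open import Data.List as List using (List; []; _∷_; length; map; filter; mapMaybe; foldr; allFin; cartesianProduct)
open import Data.Maybe as Maybe using (Maybe; nothing; just; is-just)
open import Data.Nat using (ℕ; zero; suc; _+_; _*_; _^_; _⊓_; _⊔_; _≤_; _<_; _≤?_; z≤n; s≤s; s≤s⁻¹; >-nonZero)
open import Data.Nat.Binary as ℕᵇ using (ℕᵇ; zero; 2[1+_]; 1+[2_]; fromℕ)
import Data.Nat.Binary.Properties as ℕᵇ
open import Data.Nat.Properties
open import Data.Nat.Tactic.RingSolver using (solve-∀)
open import Data.Product using (∃-syntax; _×_; _,_; proj₁; proj₂)
open import Data.Rational as ℚ using (ℚ; 0ℚ; 1ℚ)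
import Data.Rational.Properties as ℚ
open import Data.Sum using (_⊎_; inj₁; inj₂)
open import Data.Unit using (tt)
open import Data.Vec as Vec using (Vec; []; _∷_; lookup; toList; tabulate; zipWith; here; there)
import Data.Vec.Properties as Vec
open import Function using (_∘_; id)
open import Function.Bundles using (_⇔_; Equivalence; mk⇔)
open import Relation.Binary.PropositionalEquality using (_≡_; _≢_; refl; sym; trans; cong; cong₂; subst)
open import Relation.Nullary using (Dec; yes; no; does; ¬_; ¬?; contradiction)
open import Relation.Nullary.Decidable using (map′; from-yes; _×-dec_)
open import Algebra.Properties.CommutativeMonoid.Sum ℚ.+-0-commutativeMonoid using (sum; sum-cong-≗; ∑-distrib-+)
import Data.List.Membership.Propositional as List
import Data.List.Membership.Propositional.Properties as List
open import Data.List.Relation.Unary.Any using (here; there)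
import Data.Nat.Coprimality as Coprime

-- The program

-- Every set is tested directly against both the budget and the cost bound before it is accepted, so
-- acceptance is sound for every `k`; only completeness depends on the parameter. What shapes the
-- program is that numbers arrive in binary: the budget, and with it `k`, may be exponentially
-- larger than the input. Hence `k` is never unrolled. The search counts the chosen vertices upward
-- in binary and compares the counter with `k`; the counter has at most one digit per decided
-- vertex, and a comparison costs only the minimum of the two lengths. Loops that run once per
-- vertex use the list of matrix rows as their clock. A rational cost bound `p / q` is tested
-- without division, by adding up `q` once for each element of `A △ cl X` and comparing the result
-- with `p`. The number of calls is about `M * (n + 1) ^ (k + 1)` with `M` polynomial in the input
-- size `N`. As `n < N`, the time is at most `N ^ (d + k)` for a fixed `d`, and `d + k` is computed
-- by `d` successor calls.

pattern sucF     = zero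
pattern addF     = suc sucF
pattern leF      = suc addF
pattern totalF   = suc leF
pattern xorF     = suc totalF
pattern rowF     = suc xorF
pattern spreadF  = suc rowF
pattern closureF = suc spreadF
pattern getF     = suc closureF
pattern delF     = suc getF
pattern pruneF   = suc delF
pattern checkF   = suc pruneF
pattern acceptF  = suc checkF
pattern searchF  = suc acceptF

arity : Fin 14 → ℕ
arity sucF     = 1
arity addF     = 2
arity leF      = 2
arity totalF   = 2
arity xorF     = 2
arity rowF     = 2
arity spreadF  = 3
arity closureF = 3
arity getF     = 2
arity delF     = 2
arity pruneF   = 3
arity checkF   = 2
arity acceptF  = 2
arity searchF  = 5

E : ℕ → Set
E = Exp arity

v0 : ∀ {n} → E (1 + n)
v0 = var zero
v1 : ∀ {n} → E (2 + n)
v1 = var (suc zero)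
v2 : ∀ {n} → E (3 + n)
v2 = var (suc (suc zero))
v3 : ∀ {n} → E (4 + n)
v3 = var (suc (suc (suc zero)))
v4 : ∀ {n} → E (5 + n)
v4 = var (suc (suc (suc (suc zero))))
v5 : ∀ {n} → E (6 + n)
v5 = var (suc (suc (suc (suc (suc zero)))))
v6 : ∀ {n} → E (7 + n)
v6 = var (suc (suc (suc (suc (suc (suc zero))))))
v7 : ∀ {n} → E (8 + n)
v7 = var (suc (suc (suc (suc (suc (suc (suc zero)))))))
v8 : ∀ {n} → E (9 + n)
v8 = var (suc (suc (suc (suc (suc (suc (suc (suc zero))))))))
v9 : ∀ {n} → E (10 + n)
v9 = var (suc (suc (suc (suc (suc (suc (suc (suc (suc zero)))))))))
v10 : ∀ {n} → E (11 + n)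
v10 = var (suc (suc (suc (suc (suc (suc (suc (suc (suc (suc zero))))))))))
v11 : ∀ {n} → E (12 + n)
v11 = var (suc (suc (suc (suc (suc (suc (suc (suc (suc (suc (suc zero)))))))))))
v13 : ∀ {n} → E (14 + n)
v13 = var (suc (suc (suc (suc (suc (suc (suc (suc (suc (suc (suc (suc (suc zero)))))))))))))

true′ : ∀ {n} → E n
true′ = cons nil nil

-- A case on a truth value binds the two subtrees of nil ∙ nil as dummies.
body : (f : Fin 14) → E (arity f)
body sucF =
  case v0 (cons true′ nil)
    (case v0 (cons true′ (call sucF (v1 ∷ [])))
             (cons nil v3))
body addF =
  case v0 v1
    (case v3 v2
      (let′ (call addF (v3 ∷ v1 ∷ []))
        (case v3
          (case v1 (cons nil (call sucF (v0 ∷ [])))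
                   (cons true′ (call sucF (v2 ∷ []))))
          (case v3 (cons true′ (call sucF (v2 ∷ [])))
                   (cons nil v4)))))
body leF =
  case v0 true′
    (case v3 nil
      (case v2
        (case v0 (call leF (v3 ∷ v1 ∷ []))
                 (case (call leF (v3 ∷ v5 ∷ [])) true′ nil))
        (call leF (v5 ∷ v3 ∷ []))))
body totalF =
  case v0 nil
    (let′ (call totalF (v1 ∷ v3 ∷ []))
      (case v1 v0 (call addF (v6 ∷ v2 ∷ []))))
body xorF =
  case v0 nil
    (case v3 nil
      (cons (case v2 v0 (case v2 true′ nil))
            (call xorF (v3 ∷ v1 ∷ []))))
body rowF =
  case v0 nil
    (case v3 nil
      (cons (case v2 (case v0 nil true′) true′)
            (call rowF (v3 ∷ v1 ∷ []))))
body spreadF =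
  case v0 v2
    (case v3 nil
      (case v0
        (call spreadF (v3 ∷ v1 ∷ v6 ∷ []))
        (call spreadF (v5 ∷ v3 ∷ call rowF (v8 ∷ v4 ∷ []) ∷ []))))
body closureF =
  case v0 v2
    (call closureF (v1 ∷ v3 ∷ call spreadF (v3 ∷ v4 ∷ v4 ∷ []) ∷ []))
body getF =
  case v1 nil
    (case v2 v0 (call getF (v1 ∷ v3 ∷ [])))
body delF =
  case v1 nil
    (case v2 (cons nil v1) (cons v2 (call delF (v1 ∷ v3 ∷ []))))
body pruneF =
  case v0 v2
    (let′ (call delF (v1 ∷ v4 ∷ []))
      (case (call getF (v2 ∷ call closureF (v4 ∷ v4 ∷ v0 ∷ []) ∷ []))
        (call pruneF (v2 ∷ v4 ∷ v5 ∷ []))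
        (call pruneF (v4 ∷ v6 ∷ v2 ∷ []))))
body checkF =
  case v0 nil (case v1 nil (case v1 nil (case v1 nil (case v0 nil
    (case v0
      (case (call leF (call totalF (v11 ∷ cons true′ nil ∷ []) ∷ v4 ∷ []))
        nil
        (call leF (call totalF (call xorF (v8 ∷ call closureF (v10 ∷ v10 ∷ v13 ∷ []) ∷ []) ∷ v5 ∷ []) ∷ v3 ∷ [])))
      nil)))))
body acceptF =
  case (call checkF (v0 ∷ v1 ∷ []))
    (case v0 nil (case v1 nil
      (call checkF (v4 ∷ call pruneF (v2 ∷ v2 ∷ call xorF (v0 ∷ v5 ∷ []) ∷ []) ∷ []))))
    true′
body searchF =
  case v0 (call acceptF (v1 ∷ v4 ∷ []))
    (let′ (call sucF (v5 ∷ []))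
      (case (call leF (v0 ∷ v5 ∷ []))
        (call searchF (v2 ∷ v4 ∷ v5 ∷ v6 ∷ cons nil v7 ∷ []))
        (case (call searchF (v4 ∷ v6 ∷ v7 ∷ v8 ∷ cons nil v9 ∷ []))
          (call searchF (v4 ∷ v6 ∷ v7 ∷ v2 ∷ cons true′ v9 ∷ []))
          true′)))

searchMain : E 1
searchMain =
  -- The matrix is the clock of the search; the first `nil` is the counter 0, the second the empty
  -- list of decisions.
  case v0 nil (case v0 nil (call searchF (v0 ∷ v2 ∷ v3 ∷ nil ∷ nil ∷ [])))

addMain : ℕ → E 1
addMain zero    = v0
addMain (suc c) = call sucF (addMain c ∷ [])

program : E 1 → Program
program main = record { #functions = 14 ; arity = arity ; body = body ; main = main }

-- Counting function calls instead of evaluation rules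

mutual
  expSize : ∀ {n} → E n → ℕ
  expSize (var _)       = 1
  expSize nil           = 1
  expSize (cons e e₁)   = suc (expSize e + expSize e₁)
  expSize (let′ e e₁)   = suc (expSize e + expSize e₁)
  expSize (case e e₁ e₂) = suc (expSize e + (expSize e₁ + expSize e₂))
  expSize (call _ es)   = suc (expsSize es)

  expsSize : ∀ {n k} → Vec (E n) k → ℕ
  expsSize []       = 0
  expsSize (e ∷ es) = expSize e + expsSize es

infix 4 _⊢_⇓_#_ _⊢*_⇓_#_

-- ρ ⊢ e ⇓ v # c: e evaluates to v with at most c function calls.  Between
-- two calls only boundedly many rules apply, so c determines the time up
-- to a constant factor.
mutual
  data _⊢_⇓_#_ {n} (ρ : Vec Tree n) : E n → Tree → ℕ → Set where
    var    : ∀ {i} → ρ ⊢ var i ⇓ lookup ρ i # 0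
    nil    : ρ ⊢ nil ⇓ nil # 0
    cons   : ∀ {e₁ e₂ v₁ v₂ c₁ c₂} →
      ρ ⊢ e₁ ⇓ v₁ # c₁ → ρ ⊢ e₂ ⇓ v₂ # c₂ → ρ ⊢ cons e₁ e₂ ⇓ v₁ ∙ v₂ # c₁ + c₂
    let′   : ∀ {e₁ e₂ v₁ v₂ c₁ c₂} →
      ρ ⊢ e₁ ⇓ v₁ # c₁ → v₁ ∷ ρ ⊢ e₂ ⇓ v₂ # c₂ → ρ ⊢ let′ e₁ e₂ ⇓ v₂ # c₁ + c₂
    case-nil : ∀ {e e₁ e₂ v c c₁} →
      ρ ⊢ e ⇓ nil # c → ρ ⊢ e₁ ⇓ v # c₁ → ρ ⊢ case e e₁ e₂ ⇓ v # c + c₁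
    case-∙ : ∀ {e e₁ e₂ l r v c c₂} →
      ρ ⊢ e ⇓ l ∙ r # c → l ∷ r ∷ ρ ⊢ e₂ ⇓ v # c₂ → ρ ⊢ case e e₁ e₂ ⇓ v # c + c₂
    call   : ∀ {f es vs v c₁ c₂} →
      ρ ⊢* es ⇓ vs # c₁ → vs ⊢ body f ⇓ v # c₂ → ρ ⊢ call f es ⇓ v # c₁ + suc c₂
    weaken : ∀ {e v c c′} → c ≤ c′ → ρ ⊢ e ⇓ v # c → ρ ⊢ e ⇓ v # c′

  data _⊢*_⇓_#_ {n} (ρ : Vec Tree n) : ∀ {k} → Vec (E n) k → Vec Tree k → ℕ → Set where
    []  : ρ ⊢* [] ⇓ [] # 0
    _∷_ : ∀ {k e v c₁ c₂} {es : Vec _ k} {vs} →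
      ρ ⊢ e ⇓ v # c₁ → ρ ⊢* es ⇓ vs # c₂ → ρ ⊢* e ∷ es ⇓ v ∷ vs # c₁ + c₂

combine-≤ : ∀ {t₁ t₂} s₁ s₂ {c₁ c₂} k → t₁ ≤ s₁ + k * c₁ → t₂ ≤ s₂ + k * c₂ →
            suc (t₁ + t₂) ≤ suc (s₁ + s₂) + k * (c₁ + c₂)
combine-≤ s₁ s₂ {c₁} {c₂} k p q =
  ≤-trans (s≤s (+-mono-≤ p q)) (≤-reflexive (lemma s₁ s₂ c₁ c₂ k))
  where
  lemma : ∀ s₁ s₂ c₁ c₂ k →
          suc ((s₁ + k * c₁) + (s₂ + k * c₂)) ≡ suc (s₁ + s₂) + k * (c₁ + c₂)
  lemma = solve-∀

module Timing (main : E 1) {K} (body-size : ∀ f → expSize (body f) ≤ K) where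
  open Semantics (program main)

  mutual
    timed : ∀ {n} {ρ : Vec Tree n} {e v c} → ρ ⊢ e ⇓ v # c →
            ∃[ t ] t ≤ expSize e + K * c × ρ ⊢ e ⇓ v ⟨ t ⟩
    timed var = 1 , m≤m+n 1 _ , var _
    timed nil = 1 , m≤m+n 1 _ , nil
    timed (cons {e₁} {e₂} p q) with timed p | timed q
    ... | _ , t≤ , p′ | _ , u≤ , q′ =
      _ , combine-≤ (expSize e₁) (expSize e₂) K t≤ u≤ , cons p′ q′
    timed (let′ {e₁} {e₂} p q) with timed p | timed q
    ... | _ , t≤ , p′ | _ , u≤ , q′ =
      _ , combine-≤ (expSize e₁) (expSize e₂) K t≤ u≤ , let′ p′ q′
    timed (case-nil {e} {e₁} {e₂} p q) with timed p | timed q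
    ... | _ , t≤ , p′ | _ , u≤ , q′ =
      _ , combine-≤ (expSize e) (expSize e₁ + expSize e₂) K t≤
            (≤-trans u≤ (+-monoˡ-≤ _ (m≤m+n (expSize e₁) (expSize e₂)))) , case-nil p′ q′
    timed (case-∙ {e} {e₁} {e₂} p q) with timed p | timed q
    ... | _ , t≤ , p′ | _ , u≤ , q′ =
      _ , combine-≤ (expSize e) (expSize e₁ + expSize e₂) K t≤
            (≤-trans u≤ (+-monoˡ-≤ _ (m≤n+m (expSize e₂) (expSize e₁)))) , case-∙ p′ q′
    timed (call {f} {es} {c₁ = c₁} {c₂} ps p) with timed* ps | timed p
    ... | _ , t≤ , ps′ | _ , u≤ , p′ =
      -- The unit that `suc c₂` adds is charged with `K`, which pays for one pass through the body
      -- of `f`.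
      _ , ≤-trans (s≤s (+-mono-≤ t≤ (≤-trans u≤ (+-monoˡ-≤ _ (body-size f)))))
            (≤-reflexive (lemma (expsSize es) c₁ c₂ K)) , call ps′ p′
      where
      lemma : ∀ s c₁ c₂ k → suc ((s + k * c₁) + (k + k * c₂)) ≡ suc s + k * (c₁ + suc c₂)
      lemma = solve-∀
    timed (weaken {e} c≤ p) with timed p
    ... | _ , t≤ , p′ = _ , ≤-trans t≤ (+-monoʳ-≤ (expSize e) (*-monoʳ-≤ K c≤)) , p′

    timed* : ∀ {n k} {ρ : Vec Tree n} {es : Vec (E n) k} {vs c} → ρ ⊢* es ⇓ vs # c →
             ∃[ t ] t ≤ expsSize es + K * c × ρ ⊢* es ⇓ vs ⟨ t ⟩
    timed* [] = 0 , z≤n , []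
    timed* (_∷_ {e = e} {es = es} p ps) with timed p | timed* ps
    ... | _ , t≤ , p′ | _ , u≤ , ps′ =
      _ , s≤s⁻¹ (combine-≤ (expSize e) (expsSize es) K t≤ u≤) , p′ ∷ ps′

-- Evaluation of the subroutines

encVec : ∀ {A : Set} {n} → (A → Tree) → Vec A n → Tree
encVec enc = encList enc ∘ toList

Matrix : ℕ → ℕ → Set
Matrix m n = Vec (Vec (Maybe ℚ) n) m

encMatrix : ∀ {m n} → Matrix m n → Tree
encMatrix = encVec (encVec (encMaybe encℚ))

spine : Tree → ℕ
spine nil     = 0
spine (_ ∙ t) = suc (spine t)

spine-encVec : ∀ {A : Set} (enc : A → Tree) {n} (xs : Vec A n) → spine (encVec enc xs) ≡ n
spine-encVec enc []       = refl
spine-encVec enc (_ ∷ xs) = cong suc (spine-encVec enc xs)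

bits : ℕᵇ → ℕ
bits = ℕᵇ.size

-- The numerals are bijective base 2, with digits 1 and 2. Only a digit 2 against a digit 1 changes
-- the relation: `2 + 2x ≤ 1 + 2y` means `x < y`, the negation of `y ≤ x`.
leᵇ : ℕᵇ → ℕᵇ → Bool
leᵇ zero     _        = true
leᵇ 2[1+ _ ] zero     = false
leᵇ 1+[2 _ ] zero     = false
leᵇ 2[1+ x ] 2[1+ y ] = leᵇ x y
leᵇ 2[1+ x ] 1+[2 y ] = not (leᵇ y x)
leᵇ 1+[2 x ] 2[1+ y ] = leᵇ x y
leᵇ 1+[2 x ] 1+[2 y ] = leᵇ x y

-- The product of `∣ X ∣` and `d` by repeated addition. With `d = 1` it is the cardinality, so one
-- routine serves the budget test and the cost test.
total : ∀ {n} → Subset n → ℕᵇ → ℕᵇ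
total []          d = zero
total (false ∷ X) d = total X d
total (true ∷ X)  d = d ℕᵇ.+ total X d

infixl 6 _△_
_△_ : ∀ {n} → Subset n → Subset n → Subset n
_△_ = zipWith _xor_

addRow : ∀ {n} → Subset n → Vec (Maybe ℚ) n → Subset n
addRow = zipWith (λ s w → s ∨ is-just w)

-- The sources `S` stay fixed while `acc` grows, so one call advances along exactly one arc. This
-- keeps the rounds in step with those of the cascade.
spread : ∀ {m n} → Matrix m n → Subset m → Subset n → Subset n
spread []         []          acc = acc
spread (row ∷ rows) (false ∷ S) acc = spread rows S acc
spread (row ∷ rows) (true ∷ S)  acc = spread rows S (addRow acc row)

iterate : ∀ {n} → ℕ → Matrix n n → Subset n → Subset n
iterate zero    rows S = S
iterate (suc k) rows S = iterate k rows (spread rows S S)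

closure : ∀ {n} → Matrix n n → Subset n → Subset n
closure {n} = iterate n

getAt : ∀ {n} → ℕ → Subset n → Bool
getAt _       []      = false
getAt zero    (s ∷ _) = s
getAt (suc i) (_ ∷ S) = getAt i S

delAt : ∀ {n} → ℕ → Subset n → Subset n
delAt _       []      = []
delAt zero    (_ ∷ S) = false ∷ S
delAt (suc i) (s ∷ S) = s ∷ delAt i S

prune : ∀ {n} → Matrix n n → ℕ → Subset n → Subset n
prune rows zero    X = X
prune rows (suc i) X =
  if getAt i (closure rows (delAt i X)) then prune rows i (delAt i X) else prune rows i X

-- `r` is the number of vertices that may still be chosen; the program carries a rising binary
-- counter in its place. Decisions are consed, so `D` is built from the last vertex to the first.
search : ∀ {n j} (accept : Subset n → Bool) m (r : ℕ) → m + j ≡ n → Subset j → Bool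
search accept zero    r       refl D = accept D
search accept (suc m) zero    eq   D = search accept m zero (trans (+-suc m _) eq) (false ∷ D)
search accept (suc m) (suc r) eq   D =
  if search accept m (suc r) (trans (+-suc m _) eq) (false ∷ D)
  then true
  else search accept m r (trans (+-suc m _) eq) (true ∷ D)

bits-suc : ∀ x → bits (ℕᵇ.suc x) ≤ suc (bits x)
bits-suc zero     = ≤-refl
bits-suc 2[1+ x ] = s≤s (bits-suc x)
bits-suc 1+[2 x ] = n≤1+n _

bits-+ : ∀ x y → bits (x ℕᵇ.+ y) ≤ bits x + bits y
bits-+ zero     y    = ≤-refl
bits-+ 2[1+ x ] zero = m≤m+n _ 0
bits-+ 1+[2 x ] zero = m≤m+n _ 0
bits-+ 2[1+ x ] 2[1+ y ] = s≤s (≤-trans (bits-suc (x ℕᵇ.+ y))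
  (≤-trans (s≤s (bits-+ x y)) (≤-reflexive (sym (+-suc (bits x) (bits y))))))
bits-+ 2[1+ x ] 1+[2 y ] = s≤s (≤-trans (bits-suc (x ℕᵇ.+ y))
  (≤-trans (s≤s (bits-+ x y)) (≤-reflexive (sym (+-suc (bits x) (bits y))))))
bits-+ 1+[2 x ] 2[1+ y ] = s≤s (≤-trans (bits-suc (x ℕᵇ.+ y))
  (≤-trans (s≤s (bits-+ x y)) (≤-reflexive (sym (+-suc (bits x) (bits y))))))
bits-+ 1+[2 x ] 1+[2 y ] = s≤s (≤-trans (bits-+ x y) (+-monoʳ-≤ (bits x) (n≤1+n _)))

bits-total : ∀ {n} (X : Subset n) d → bits (total X d) ≤ n * bits d
bits-total []          d = z≤n
bits-total (false ∷ X) d = ≤-trans (bits-total X d) (m≤n+m _ _)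
bits-total (true ∷ X)  d = ≤-trans (bits-+ d (total X d)) (+-monoʳ-≤ (bits d) (bits-total X d))

true-⇓ : ∀ {n} {ρ : Vec Tree n} → ρ ⊢ true′ ⇓ encBool true # 0
true-⇓ = cons nil nil

if-⇓ : ∀ {A : Set} (enc : A → Tree) {n} {ρ : Vec Tree n} {e e₁ e₂ x₁ x₂ c c′} b →
       ρ ⊢ e ⇓ encBool b # c → ρ ⊢ e₁ ⇓ enc x₁ # c′ → nil ∷ nil ∷ ρ ⊢ e₂ ⇓ enc x₂ # c′ →
       ρ ⊢ case e e₁ e₂ ⇓ enc (if b then x₂ else x₁) # c + c′
if-⇓ enc false p p₁ p₂ = case-nil p p₁
if-⇓ enc true  p p₁ p₂ = case-∙ p p₂

suc-⇓ : ∀ x → encℕᵇ x ∷ [] ⊢ body sucF ⇓ encℕᵇ (ℕᵇ.suc x) # bits x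
suc-⇓ zero     = case-nil var (cons true-⇓ nil)
suc-⇓ 2[1+ x ] = case-∙ var (case-nil var (cons true-⇓ (call (var ∷ []) (suc-⇓ x))))
suc-⇓ 1+[2 x ] = weaken z≤n (case-∙ var (case-∙ var (cons nil var)))

-- Carries are not passed along: the recursive sum is corrected by a successor afterwards, which may
-- walk through all of its at most `a + b` digits on each of at most `a` levels. Hence a quadratic
-- bound.
addCalls : ℕ → ℕ → ℕ
addCalls a b = a * (2 + (a + b))

addCalls-step : ∀ a b {c} → c ≤ a + b → suc (addCalls a b) + suc c ≤ addCalls (suc a) (suc b)
addCalls-step a b {c} c≤ = begin
  suc (addCalls a b) + suc c                     ≤⟨ +-monoʳ-≤ (suc (addCalls a b)) (s≤s c≤) ⟩
  suc (addCalls a b) + suc (a + b)               ≤⟨ m≤m+n _ (2 + 2 * a) ⟩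
  suc (addCalls a b) + suc (a + b) + (2 + 2 * a) ≡⟨ lemma a b ⟩
  addCalls (suc a) (suc b)                       ∎
  where
  open ≤-Reasoning
  lemma : ∀ a b → suc (a * (2 + (a + b))) + suc (a + b) + (2 + 2 * a) ≡ suc a * (2 + (suc a + suc b))
  lemma = solve-∀

add-⇓ : ∀ x y → encℕᵇ x ∷ encℕᵇ y ∷ [] ⊢ body addF ⇓ encℕᵇ (x ℕᵇ.+ y) # addCalls (bits x) (bits y)
add-⇓ zero     y    = case-nil var var
add-⇓ 2[1+ x ] zero = weaken z≤n (case-∙ var (case-nil var var))
add-⇓ 1+[2 x ] zero = weaken z≤n (case-∙ var (case-nil var var))
add-⇓ 2[1+ x ] 2[1+ y ] = weaken (addCalls-step (bits x) (bits y) (bits-+ x y))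
  (case-∙ var (case-∙ var (let′ (call (var ∷ var ∷ []) (add-⇓ x y))
    (case-nil var (case-nil var (cons nil (call (var ∷ []) (suc-⇓ (x ℕᵇ.+ y)))))))))
add-⇓ 2[1+ x ] 1+[2 y ] = weaken (addCalls-step (bits x) (bits y) (bits-+ x y))
  (case-∙ var (case-∙ var (let′ (call (var ∷ var ∷ []) (add-⇓ x y))
    (case-nil var (case-∙ var (cons true-⇓ (call (var ∷ []) (suc-⇓ (x ℕᵇ.+ y)))))))))
add-⇓ 1+[2 x ] 2[1+ y ] = weaken (addCalls-step (bits x) (bits y) (bits-+ x y))
  (case-∙ var (case-∙ var (let′ (call (var ∷ var ∷ []) (add-⇓ x y))
    (case-∙ var (case-nil var (cons true-⇓ (call (var ∷ []) (suc-⇓ (x ℕᵇ.+ y)))))))))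
add-⇓ 1+[2 x ] 1+[2 y ] = weaken (addCalls-step (bits x) (bits y) (bits-+ x y))
  (case-∙ var (case-∙ var (let′ (call (var ∷ var ∷ []) (add-⇓ x y))
    (weaken z≤n (case-∙ var (case-∙ var (cons nil var)))))))

-- The minimum keeps comparisons with a long budget or numerator cheap, and it is symmetric, as the
-- case that swaps the arguments requires.
le-⇓ : ∀ x y → encℕᵇ x ∷ encℕᵇ y ∷ [] ⊢ body leF ⇓ encBool (leᵇ x y) # bits x ⊓ bits y
le-⇓ zero     y        = case-nil var true-⇓
le-⇓ 2[1+ x ] zero     = case-∙ var (case-nil var nil)
le-⇓ 1+[2 x ] zero     = case-∙ var (case-nil var nil)
le-⇓ 2[1+ x ] 2[1+ y ] =
  case-∙ var (case-∙ var (case-nil var (case-nil var (call (var ∷ var ∷ []) (le-⇓ x y)))))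
le-⇓ 2[1+ x ] 1+[2 y ] =
  weaken (≤-reflexive (trans (+-identityʳ _) (cong suc (⊓-comm (bits y) (bits x)))))
    (case-∙ var (case-∙ var (case-nil var (case-∙ var
      (not-⇓ (leᵇ y x) (call (var ∷ var ∷ []) (le-⇓ y x)))))))
  where
  not-⇓ : ∀ {n} {ρ : Vec Tree n} {e c} b → ρ ⊢ e ⇓ encBool b # c →
          ρ ⊢ case e true′ nil ⇓ encBool (not b) # c + 0
  not-⇓ false p = case-nil p true-⇓
  not-⇓ true  p = case-∙ p nil
le-⇓ 1+[2 x ] 2[1+ y ] =
  case-∙ var (case-∙ var (case-∙ var (call (var ∷ var ∷ []) (le-⇓ x y))))
le-⇓ 1+[2 x ] 1+[2 y ] =
  case-∙ var (case-∙ var (case-∙ var (call (var ∷ var ∷ []) (le-⇓ x y))))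

totalCalls : ℕ → ℕ → ℕ
totalCalls n ℓ = n * (2 + addCalls ℓ (n * ℓ))

total-⇓ : ∀ {n} (X : Subset n) d →
  encSubset X ∷ encℕᵇ d ∷ [] ⊢ body totalF ⇓ encℕᵇ (total X d) # totalCalls n (bits d)
total-⇓ {n} X d = go X ≤-refl
  where
  -- The cost of one addition, taken for the full dimension `n`, so that all levels of the recursion
  -- are charged equally.
  a : ℕ
  a = addCalls (bits d) (n * bits d)
  step : ∀ c → suc c + suc a ≤ (2 + a) + c
  step c = ≤-reflexive (lemma a c)
    where
    lemma : ∀ a c → suc c + suc a ≡ (2 + a) + c
    lemma = solve-∀
  go : ∀ {m} (X : Subset m) → m ≤ n →
       encSubset X ∷ encℕᵇ d ∷ [] ⊢ body totalF ⇓ encℕᵇ (total X d) # m * (2 + a)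
  go []          m≤n = case-nil var nil
  go {suc m} (false ∷ X) m≤n = weaken (step (m * (2 + a)))
    (case-∙ var (let′ (call (var ∷ var ∷ []) (go X (≤-trans (n≤1+n _) m≤n)))
      (weaken z≤n (case-nil var var))))
  go {suc m} (true ∷ X)  m≤n = weaken (step (m * (2 + a)))
    (case-∙ var (let′ (call (var ∷ var ∷ []) (go X (≤-trans (n≤1+n _) m≤n)))
      (weaken (s≤s (*-monoʳ-≤ (bits d) (s≤s (s≤s (+-monoʳ-≤ (bits d)
          (≤-trans (bits-total X d) (*-monoˡ-≤ (bits d) (≤-trans (n≤1+n _) m≤n))))))))
        (case-∙ var (call (var ∷ var ∷ []) (add-⇓ d (total X d)))))))

xor-⇓ : ∀ {n} (A S : Subset n) →
  encSubset A ∷ encSubset S ∷ [] ⊢ body xorF ⇓ encSubset (A △ S) # n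
xor-⇓ []          []          = case-nil var nil
xor-⇓ (false ∷ A) (s ∷ S)     =
  case-∙ var (case-∙ var (cons (case-nil var var) (call (var ∷ var ∷ []) (xor-⇓ A S))))
xor-⇓ (true ∷ A)  (false ∷ S) =
  case-∙ var (case-∙ var (cons (case-∙ var (case-nil var true-⇓)) (call (var ∷ var ∷ []) (xor-⇓ A S))))
xor-⇓ (true ∷ A)  (true ∷ S)  =
  case-∙ var (case-∙ var (cons (case-∙ var (case-∙ var nil)) (call (var ∷ var ∷ []) (xor-⇓ A S))))

row-⇓ : ∀ {n} (S : Subset n) (row : Vec (Maybe ℚ) n) →
  encSubset S ∷ encVec (encMaybe encℚ) row ∷ [] ⊢ body rowF ⇓ encSubset (addRow S row) # n
row-⇓ []          []              = case-nil var nil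
row-⇓ (false ∷ S) (nothing ∷ row) =
  case-∙ var (case-∙ var (cons (case-nil var (case-nil var nil)) (call (var ∷ var ∷ []) (row-⇓ S row))))
row-⇓ (false ∷ S) (just _ ∷ row)  =
  case-∙ var (case-∙ var (cons (case-nil var (case-∙ var true-⇓)) (call (var ∷ var ∷ []) (row-⇓ S row))))
row-⇓ (true ∷ S)  (_ ∷ row)       =
  case-∙ var (case-∙ var (cons (case-∙ var true-⇓) (call (var ∷ var ∷ []) (row-⇓ S row))))

private
  nested-call : ∀ a c → (suc a + 0) + suc c ≤ (2 + a) + c
  nested-call a c = ≤-reflexive (lemma a c)
    where
    lemma : ∀ a c → (suc a + 0) + suc c ≡ (2 + a) + c
    lemma = solve-∀

spread-⇓ : ∀ {m n} (rows : Matrix m n) S acc →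
  encMatrix rows ∷ encSubset S ∷ encSubset acc ∷ []
    ⊢ body spreadF ⇓ encSubset (spread rows S acc) # m * (2 + n)
spread-⇓ []           []          acc = case-nil var var
spread-⇓ {suc m} {n} (row ∷ rows) (false ∷ S) acc = weaken (s≤s (m≤n+m _ (1 + n)))
  (case-∙ var (case-∙ var (case-nil var (call (var ∷ var ∷ var ∷ []) (spread-⇓ rows S acc)))))
spread-⇓ {suc m} {n} (row ∷ rows) (true ∷ S)  acc = weaken (nested-call n (m * (2 + n)))
  (case-∙ var (case-∙ var (case-∙ var
    (call (var ∷ var ∷ call (var ∷ var ∷ []) (row-⇓ acc row) ∷ [])
      (spread-⇓ rows S (addRow acc row))))))

iterate-⇓ : ∀ {n} l (rows : Matrix n n) S →
  l ∷ encMatrix rows ∷ encSubset S ∷ []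
    ⊢ body closureF ⇓ encSubset (iterate (spine l) rows S) # spine l * (2 + n * (2 + n))
iterate-⇓     nil     rows S = case-nil var var
iterate-⇓ {n} (_ ∙ l) rows S = weaken (nested-call (n * (2 + n)) (spine l * (2 + n * (2 + n))))
  (case-∙ var (call (var ∷ var ∷ call (var ∷ var ∷ var ∷ []) (spread-⇓ rows S S) ∷ [])
    (iterate-⇓ l rows (spread rows S S))))

closureCalls : ℕ → ℕ
closureCalls n = n * (2 + n * (2 + n))

closure-⇓ : ∀ {n} (rows : Matrix n n) S →
  encMatrix rows ∷ encMatrix rows ∷ encSubset S ∷ []
    ⊢ body closureF ⇓ encSubset (closure rows S) # closureCalls n
closure-⇓ {n} rows S =
  subst (λ k → encMatrix rows ∷ encMatrix rows ∷ encSubset S ∷ []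
          ⊢ body closureF ⇓ encSubset (iterate k rows S) # k * (2 + n * (2 + n)))
    (spine-encVec _ rows) (iterate-⇓ (encMatrix rows) rows S)

get-⇓ : ∀ {n} i (S : Subset n) →
  i ∷ encSubset S ∷ [] ⊢ body getF ⇓ encBool (getAt (spine i) S) # n
get-⇓ i       []      = case-nil var nil
get-⇓ nil     (s ∷ S) = weaken z≤n (case-∙ var (case-nil var var))
get-⇓ (_ ∙ i) (s ∷ S) = case-∙ var (case-∙ var (call (var ∷ var ∷ []) (get-⇓ i S)))

del-⇓ : ∀ {n} i (S : Subset n) →
  i ∷ encSubset S ∷ [] ⊢ body delF ⇓ encSubset (delAt (spine i) S) # n
del-⇓ i       []      = case-nil var nil
del-⇓ nil     (s ∷ S) = weaken z≤n (case-∙ var (case-nil var (cons nil var)))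
del-⇓ (_ ∙ i) (s ∷ S) = case-∙ var (case-∙ var (cons var (call (var ∷ var ∷ []) (del-⇓ i S))))

pruneStep : ℕ → ℕ
pruneStep n = 4 + (n + n + closureCalls n)

prune-⇓ : ∀ {n} l (rows : Matrix n n) X →
  l ∷ encMatrix rows ∷ encSubset X ∷ []
    ⊢ body pruneF ⇓ encSubset (prune rows (spine l) X) # spine l * pruneStep n
prune-⇓     nil     rows X = case-nil var var
prune-⇓ {n} (_ ∙ l) rows X =
  weaken (≤-reflexive (lemma n (closureCalls n) (spine l * pruneStep n)))
    (case-∙ var (let′ (call (var ∷ var ∷ []) (del-⇓ l X))
      (if-⇓ encSubset (getAt (spine l) (closure rows X′))
        (call (var ∷ call (var ∷ var ∷ var ∷ []) (closure-⇓ rows X′) ∷ [])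
          (get-⇓ l (closure rows X′)))
        (call (var ∷ var ∷ var ∷ []) (prune-⇓ l rows X))
        (call (var ∷ var ∷ var ∷ []) (prune-⇓ l rows X′)))))
  where
  X′ : Subset n
  X′ = delAt (spine l) X
  lemma : ∀ n c r → suc n + (((suc c + 0) + suc n) + suc r) ≡ (4 + (n + n + c)) + r
  lemma = solve-∀

withinBound : ℤ → ℕᵇ → Bool
withinBound (+ m)    w = leᵇ w (fromℕ m)
withinBound -[1+ _ ] w = false

module _ {n} (rows : Matrix n n) (A : Subset n) (b : ℕᵇ) (z : ℤ) (d : ℕᵇ) where

  check : Subset n → Bool
  check X =
    if leᵇ (total X 1+[2 zero ]) b then withinBound z (total (A △ closure rows X) d) else false

  accept : Subset n → Bool
  accept D = if check D then true else check (prune rows n (A △ D))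

  encData : Tree
  encData = encMatrix rows ∙ encSubset A ∙ encℕᵇ b ∙ encℤ z ∙ encℕᵇ d

checkCalls : ℕ → ℕ → ℕ
checkCalls n ℓ =
  6 + (totalCalls n 1 + (n * 1 + (closureCalls n + (n + (totalCalls n ℓ + n * ℓ)))))

acceptCalls : ℕ → ℕ → ℕ
acceptCalls n ℓ = 4 + (checkCalls n ℓ + (n + (n * pruneStep n + checkCalls n ℓ)))

nodeCalls : ℕ → ℕ → ℕ
nodeCalls n ℓ = 5 + (n + (n + acceptCalls n ℓ))

check-⇓ : ∀ {n} (rows : Matrix n n) A b z d X →
  encData rows A b z d ∷ encSubset X ∷ []
    ⊢ body checkF ⇓ encBool (check rows A b z d X) # checkCalls n (bits d)
check-⇓ {n} rows A b (+ m) d X =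
  weaken (≤-reflexive (lemma (totalCalls n 1) (n * 1) (closureCalls n) n (totalCalls n (bits d)) (n * bits d)))
    (case-∙ var (case-∙ var (case-∙ var (case-∙ var (case-∙ var (case-nil var
      (if-⇓ encBool (leᵇ (total X 1+[2 zero ]) b)
        (call (call (var ∷ cons true-⇓ nil ∷ []) (total-⇓ X 1+[2 zero ]) ∷ var ∷ [])
          (short (bits-total X 1+[2 zero ]) b))
        (weaken z≤n nil)
        (call (call (call (var ∷ call (var ∷ var ∷ var ∷ []) (closure-⇓ rows X) ∷ [])
                (xor-⇓ A (closure rows X)) ∷ var ∷ []) (total-⇓ (A △ closure rows X) d) ∷ var ∷ [])
          (short (bits-total (A △ closure rows X) d) (fromℕ m))))))))))
  where
  short : ∀ {x c} → bits x ≤ c → ∀ y → encℕᵇ x ∷ encℕᵇ y ∷ [] ⊢ body leF ⇓ encBool (leᵇ x y) # c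
  short {x} x≤c y = weaken (≤-trans (m⊓n≤m _ _) x≤c) (le-⇓ x y)
  lemma : ∀ w₁ l₁ c n w₂ l₂ →
    ((suc w₁ + 0) + suc l₁) + ((((((suc c + 0) + suc n) + 0) + suc w₂) + 0) + suc l₂)
      ≡ 6 + (w₁ + (l₁ + (c + (n + (w₂ + l₂)))))
  lemma = solve-∀
check-⇓ rows A b -[1+ m ] d X with leᵇ (total X 1+[2 zero ]) b
... | true  = weaken z≤n
  (case-∙ var (case-∙ var (case-∙ var (case-∙ var (case-∙ var (case-∙ var nil))))))
... | false = weaken z≤n
  (case-∙ var (case-∙ var (case-∙ var (case-∙ var (case-∙ var (case-∙ var nil))))))

accept-⇓ : ∀ {n} (rows : Matrix n n) A b z d D →
  encData rows A b z d ∷ encSubset D ∷ []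
    ⊢ body acceptF ⇓ encBool (accept rows A b z d D) # acceptCalls n (bits d)
accept-⇓ {n} rows A b z d D =
  weaken (≤-reflexive (lemma (checkCalls n (bits d)) n (n * pruneStep n)))
    (if-⇓ encBool (check rows A b z d D)
      (call (var ∷ var ∷ []) (check-⇓ rows A b z d D))
      (case-∙ var (case-∙ var
        (call (var ∷ call (var ∷ var ∷ call (var ∷ var ∷ []) (xor-⇓ A D) ∷ []) prune′ ∷ [])
          (check-⇓ rows A b z d (prune rows n (A △ D))))))
      (weaken z≤n true-⇓))
  where
  prune′ : encMatrix rows ∷ encMatrix rows ∷ encSubset (A △ D) ∷ []
             ⊢ body pruneF ⇓ encSubset (prune rows n (A △ D)) # n * pruneStep n
  prune′ = subst (λ k → encMatrix rows ∷ encMatrix rows ∷ encSubset (A △ D) ∷ []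
      ⊢ body pruneF ⇓ encSubset (prune rows k (A △ D)) # k * pruneStep n)
    (spine-encVec _ rows) (prune-⇓ (encMatrix rows) rows (A △ D))
  lemma : ∀ c n p → suc c + ((((suc n + 0) + suc p) + 0) + suc c) ≡ 4 + (c + (n + (p + c)))
  lemma = solve-∀

-- Comparison of binary numerals

leᵇ⇔≤ : ∀ x y → T (leᵇ x y) ⇔ ℕᵇ.toℕ x ≤ ℕᵇ.toℕ y
leᵇ⇔≤ x y = mk⇔ (to x y) (from x y)
  where
  odd<even : ∀ m n → suc (2 * m) ≤ 2 * suc n → m ≤ n
  odd<even m n p = s≤s⁻¹ (*-cancelˡ-< 2 m (suc n) p)

  to : ∀ x y → T (leᵇ x y) → ℕᵇ.toℕ x ≤ ℕᵇ.toℕ y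
  from : ∀ x y → ℕᵇ.toℕ x ≤ ℕᵇ.toℕ y → T (leᵇ x y)
  to zero     y        _ = z≤n
  to 2[1+ x ] 2[1+ y ] p = *-monoʳ-≤ 2 (s≤s (to x y p))
  to 1+[2 x ] 2[1+ y ] p = ≤-trans (s≤s (*-monoʳ-≤ 2 (to x y p)))
    (≤-trans (n≤1+n _) (≤-reflexive (sym (*-suc 2 (ℕᵇ.toℕ y)))))
  to 1+[2 x ] 1+[2 y ] p = s≤s (*-monoʳ-≤ 2 (to x y p))
  -- This case is decided by negating the swapped comparison, so each direction of the equivalence
  -- calls the other here.
  to 2[1+ x ] 1+[2 y ] p = ≤-trans (*-monoʳ-≤ 2 x<y) (n≤1+n _)
    where
    x<y : ℕᵇ.toℕ x < ℕᵇ.toℕ y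
    x<y = ≰⇒> λ y≤x → neg (leᵇ y x) p (from y x y≤x)
      where
      neg : ∀ b → T (not b) → T b → ⊥
      neg true ()
      neg false _ ()

  from zero     y        _ = tt
  from 2[1+ x ] 2[1+ y ] p = from x y (s≤s⁻¹ (*-cancelˡ-≤ 2 p))
  from 1+[2 x ] 2[1+ y ] p = from x y (odd<even _ _ p)
  from 1+[2 x ] 1+[2 y ] p = from x y (*-cancelˡ-≤ 2 (s≤s⁻¹ p))
  from 2[1+ x ] 1+[2 y ] p = pos (leᵇ y x) λ q → <⇒≱ x<y (to y x q)
    where
    x<y : ℕᵇ.toℕ x < ℕᵇ.toℕ y
    x<y = ≰⇒> λ y≤x → <⇒≱ (≤-trans (s≤s (s≤s (*-monoʳ-≤ 2 y≤x)))
      (≤-reflexive (sym (*-suc 2 (ℕᵇ.toℕ x))))) p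
    pos : ∀ b → ¬ T b → T (not b)
    pos true  ¬b = ¬b tt
    pos false _  = tt

leᵇ-true : ∀ x y → ℕᵇ.toℕ x ≤ ℕᵇ.toℕ y → leᵇ x y ≡ true
leᵇ-true x y p = Equivalence.to T-≡ (Equivalence.from (leᵇ⇔≤ x y) p)

leᵇ-false : ∀ x y → ℕᵇ.toℕ y < ℕᵇ.toℕ x → leᵇ x y ≡ false
leᵇ-false x y p with leᵇ x y in eq
... | false = refl
... | true  = contradiction (Equivalence.to (leᵇ⇔≤ x y) (Equivalence.from T-≡ eq)) (<⇒≱ p)

-- Size of the search tree

pow-step : ∀ m r → 1 + suc m ^ suc (suc r) + suc m ^ suc r ≤ suc (suc m) ^ suc (suc r)
pow-step m r = begin
  -- With `a = suc m`, a further summand `a` completes the product `(a + 1) * (p + 1)`, and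
  -- `p + 1 ≤ (a + 1) ^ suc r` by strict monotonicity of powers.
  1 + suc m * p + p                 ≤⟨ m≤m+n _ (suc m) ⟩
  1 + suc m * p + p + suc m         ≡⟨ lemma (suc m) p ⟩
  suc (suc m) * suc p               ≤⟨ *-monoʳ-≤ (suc (suc m)) (^-monoˡ-< (suc r) (n<1+n (suc m))) ⟩
  suc (suc m) * suc (suc m) ^ suc r ∎
  where
  open ≤-Reasoning
  p : ℕ
  p = suc m ^ suc r
  lemma : ∀ a p → 1 + a * p + p + a ≡ suc a * suc p
  lemma = solve-∀

-- A closed form above the solution of `T (m + 1) (r + 1) = M + T m (r + 1) + T m r` and `T (m + 1)
-- 0 = M + T m 0`, where `M` pays for the work at one node.
searchCalls : ℕ → ℕ → ℕ → ℕ
searchCalls M m r = M * suc m ^ suc r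

searchCalls-step₀ : ∀ {n M} m → 5 + (n + n) ≤ M →
  suc n + (suc (suc n) + suc (searchCalls M m 0)) ≤ searchCalls M (suc m) 0
searchCalls-step₀ {n} {M} m M≥ = begin
  suc n + (suc (suc n) + suc (M * q)) ≤⟨ n≤1+n _ ⟩
  suc (suc n + (suc (suc n) + suc (M * q))) ≡⟨ lemma n (M * q) ⟩
  5 + (n + n) + M * q                 ≤⟨ +-monoˡ-≤ (M * q) M≥ ⟩
  M + M * q                           ≡⟨ *-suc M q ⟨
  M * suc q                           ∎
  where
  open ≤-Reasoning
  q : ℕ
  q = suc m ^ 1
  lemma : ∀ n c → suc (suc n + (suc (suc n) + suc c)) ≡ 5 + (n + n) + c
  lemma = solve-∀

searchCalls-step : ∀ {n M} m r → 5 + (n + n) ≤ M →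
  suc n + (suc (suc n) + (suc (searchCalls M m (suc r)) + suc (searchCalls M m r)))
    ≤ searchCalls M (suc m) (suc r)
searchCalls-step {n} {M} m r M≥ = begin
  suc n + (suc (suc n) + (suc (M * p) + suc (M * q))) ≡⟨ lemma n (M * p) (M * q) ⟩
  5 + (n + n) + M * p + M * q                         ≤⟨ +-monoˡ-≤ (M * q) (+-monoˡ-≤ (M * p) M≥) ⟩
  M + M * p + M * q                                   ≡⟨ lemma′ M p q ⟩
  M * (1 + p + q)                                     ≤⟨ *-monoʳ-≤ M (pow-step m r) ⟩
  M * suc (suc m) ^ suc (suc r)                       ∎
  where
  open ≤-Reasoning
  p q : ℕ
  p = suc m ^ suc (suc r)
  q = suc m ^ suc r
  lemma : ∀ n c c′ → suc n + (suc (suc n) + (suc c + suc c′)) ≡ 5 + (n + n) + c + c′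
  lemma = solve-∀
  lemma′ : ∀ M p q → M + M * p + M * q ≡ M * (1 + p + q)
  lemma′ = solve-∀

-- Two invariants tie the counter to the model: counter and remaining choices add up to `k`, and the
-- counter has at most as many digits as decisions have been made. The second bounds every
-- comparison in terms of `n`, however large `k` is.
search-⇓ : ∀ {n} (rows : Matrix n n) A b z d k l r cnt {j} (D : Subset j) (eq : spine l + j ≡ n) →
  ℕᵇ.toℕ cnt + r ≡ ℕᵇ.toℕ k → bits cnt ≤ j →
  l ∷ encData rows A b z d ∷ encℕᵇ k ∷ encℕᵇ cnt ∷ encSubset D ∷ []
    ⊢ body searchF ⇓ encBool (search (accept rows A b z d) (spine l) r eq D)
    # searchCalls (nodeCalls n (bits d)) (spine l) r
search-⇓ {n} rows A b z d k nil r cnt D refl cnt≡ cnt≤ = weaken enough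
  (case-nil var (call (var ∷ var ∷ []) (accept-⇓ rows A b z d D)))
  where
  M : ℕ
  M = nodeCalls n (bits d)
  enough : suc (acceptCalls n (bits d)) ≤ M * 1 ^ suc r
  enough = begin
    suc (acceptCalls n (bits d))                 ≤⟨ s≤s (≤-trans (m≤n+m _ n) (m≤n+m _ n)) ⟩
    suc (n + (n + acceptCalls n (bits d)))       ≤⟨ m≤n+m _ 4 ⟩
    M                                         ≡⟨ *-identityʳ M ⟨
    M * 1                                     ≡⟨ cong (M *_) (^-zeroˡ (suc r)) ⟨
    M * 1 ^ suc r                             ∎
    where open ≤-Reasoning
search-⇓ {n} rows A b z d k (h ∙ l) r cnt {j} D eq cnt≡ cnt≤ = go r cnt≡
  where
  M : ℕ
  M = nodeCalls n (bits d)
  M≥ : 5 + (n + n) ≤ M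
  M≥ = +-monoʳ-≤ 5 (+-monoʳ-≤ n (m≤m+n n _))
  eq′ : spine l + suc j ≡ n
  eq′ = trans (+-suc (spine l) j) eq
  cnt≤n : bits cnt ≤ n
  cnt≤n = ≤-trans cnt≤ (≤-trans (m≤n+m j (suc (spine l))) (≤-reflexive eq))
  cnt′≤n : bits (ℕᵇ.suc cnt) ⊓ bits k ≤ suc n
  cnt′≤n = ≤-trans (m⊓n≤m _ _) (≤-trans (bits-suc cnt) (s≤s cnt≤n))
  le-suc-⇓ : ∀ {b} → leᵇ (ℕᵇ.suc cnt) k ≡ b →
    encℕᵇ (ℕᵇ.suc cnt) ∷ encℕᵇ k ∷ [] ⊢ body leF ⇓ encBool b # suc n
  le-suc-⇓ refl = weaken cnt′≤n (le-⇓ (ℕᵇ.suc cnt) k)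
  go : ∀ r → ℕᵇ.toℕ cnt + r ≡ ℕᵇ.toℕ k →
    (h ∙ l) ∷ encData rows A b z d ∷ encℕᵇ k ∷ encℕᵇ cnt ∷ encSubset D ∷ []
      ⊢ body searchF ⇓ encBool (search (accept rows A b z d) (suc (spine l)) r eq D)
      # searchCalls M (suc (spine l)) r
  go zero cnt≡k = weaken (searchCalls-step₀ (spine l) M≥)
    (case-∙ var (let′ (call (var ∷ []) (weaken cnt≤n (suc-⇓ cnt)))
      (case-nil (call (var ∷ var ∷ []) (le-suc-⇓ (leᵇ-false (ℕᵇ.suc cnt) k k<)))
        (call (var ∷ var ∷ var ∷ var ∷ cons nil var ∷ [])
          (search-⇓ rows A b z d k l zero cnt (false ∷ D) eq′ cnt≡k (≤-trans cnt≤ (n≤1+n j)))))))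
    where
    -- No choice is left exactly when the counter equals `k`, and then the test of its successor
    -- against `k` fails.
    k< : ℕᵇ.toℕ k < ℕᵇ.toℕ (ℕᵇ.suc cnt)
    k< = ≤-reflexive (trans (cong suc (trans (sym cnt≡k) (+-identityʳ _))) (sym (ℕᵇ.toℕ-suc cnt)))
  go (suc r) cnt≡k = weaken (searchCalls-step (spine l) r M≥)
    (case-∙ var (let′ (call (var ∷ []) (weaken cnt≤n (suc-⇓ cnt)))
      (case-∙ (call (var ∷ var ∷ []) (le-suc-⇓ (leᵇ-true (ℕᵇ.suc cnt) k ≤k)))
        (if-⇓ encBool (search (accept rows A b z d) (spine l) (suc r) eq′ (false ∷ D))
          (call (var ∷ var ∷ var ∷ var ∷ cons nil var ∷ [])
            (search-⇓ rows A b z d k l (suc r) cnt (false ∷ D) eq′ cnt≡k (≤-trans cnt≤ (n≤1+n j))))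
          (call (var ∷ var ∷ var ∷ var ∷ cons true-⇓ var ∷ [])
            (search-⇓ rows A b z d k l r (ℕᵇ.suc cnt) (true ∷ D) eq′ cnt′≡k
              (≤-trans (bits-suc cnt) (s≤s cnt≤))))
          (weaken z≤n true-⇓)))))
    where
    cnt′≡k : ℕᵇ.toℕ (ℕᵇ.suc cnt) + r ≡ ℕᵇ.toℕ k
    cnt′≡k = trans (cong (_+ r) (ℕᵇ.toℕ-suc cnt)) (trans (sym (+-suc _ r)) cnt≡k)
    ≤k : ℕᵇ.toℕ (ℕᵇ.suc cnt) ≤ ℕᵇ.toℕ k
    ≤k = ≤-trans (m≤m+n _ r) (≤-reflexive cnt′≡k)

-- Running time

-- `N` stands for the input size, `n` for the number of vertices, `ℓ` for the digits of the
-- denominator. `2 ≤ N` lets a single power of `N` absorb sums and constants; `f` also takes `N`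
-- because of the factor that `time-split` produces.
PolyBounded : (ℕ → ℕ → ℕ → ℕ) → Set
PolyBounded f = ∃[ e ] ∀ {n ℓ N} → 2 ≤ N → n ≤ N → ℓ ≤ N → f n ℓ N ≤ N ^ e

module Polynomial where

  ≤-^-mono : ∀ {x N a b} → 2 ≤ N → x ≤ N ^ a → a ≤ b → x ≤ N ^ b
  ≤-^-mono {N = suc N} 2≤N x≤ a≤b = ≤-trans x≤ (^-monoʳ-≤ (suc N) a≤b)

  dim len scale : PolyBounded _
  dim   = 1 , λ {n} {ℓ} {N} _ n≤N _ → ≤-trans n≤N (≤-reflexive (sym (*-identityʳ N)))
  len   = 1 , λ {n} {ℓ} {N} _ _ ℓ≤N → ≤-trans ℓ≤N (≤-reflexive (sym (*-identityʳ N)))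
  scale = 1 , λ {n} {ℓ} {N} _ _ _ → ≤-reflexive (sym (*-identityʳ N))

  infixl 6 _⊕_
  _⊕_ : ∀ {f g} → PolyBounded f → PolyBounded g → PolyBounded λ n ℓ N → f n ℓ N + g n ℓ N
  _⊕_ {f} {g} (a , f≤) (b , g≤) = suc (a ⊔ b) , λ {n} {ℓ} {N} 2≤N n≤N ℓ≤N → begin
    f n ℓ N + g n ℓ N         ≤⟨ +-mono-≤ (≤-^-mono 2≤N (f≤ 2≤N n≤N ℓ≤N) (m≤m⊔n a b))
                                          (≤-^-mono 2≤N (g≤ 2≤N n≤N ℓ≤N) (m≤n⊔m a b)) ⟩
    N ^ (a ⊔ b) + N ^ (a ⊔ b) ≤⟨ +-monoʳ-≤ (N ^ (a ⊔ b)) (m≤m+n _ 0) ⟩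
    2 * N ^ (a ⊔ b)           ≤⟨ *-monoˡ-≤ (N ^ (a ⊔ b)) 2≤N ⟩
    N ^ suc (a ⊔ b)           ∎
    where open ≤-Reasoning

  infixl 7 _⊗_
  _⊗_ : ∀ {f g} → PolyBounded f → PolyBounded g → PolyBounded λ n ℓ N → f n ℓ N * g n ℓ N
  (a , f≤) ⊗ (b , g≤) = a + b , λ {n} {ℓ} {N} 2≤N n≤N ℓ≤N →
    ≤-trans (*-mono-≤ (f≤ 2≤N n≤N ℓ≤N) (g≤ 2≤N n≤N ℓ≤N)) (≤-reflexive (sym (^-distribˡ-+-* N a b)))

  -- A constant is a sum of ones and each summand raises the exponent by one, so this is
  -- `c ≤ N ^ c`: crude, but of fixed degree.
  const : ∀ c → PolyBounded λ _ _ _ → c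
  const zero    = 0 , λ _ _ _ → z≤n
  const (suc c) = (0 , λ _ _ _ → ≤-refl) ⊕ const c

  addCalls-poly : ∀ {f g} → PolyBounded f → PolyBounded g →
                  PolyBounded λ n ℓ N → addCalls (f n ℓ N) (g n ℓ N)
  addCalls-poly f g = f ⊗ (const 2 ⊕ (f ⊕ g))

  totalCalls-poly : ∀ {g} → PolyBounded g → PolyBounded λ n ℓ N → totalCalls n (g n ℓ N)
  totalCalls-poly g = dim ⊗ (const 2 ⊕ addCalls-poly g (dim ⊗ g))

  closureCalls-poly : PolyBounded λ n _ _ → closureCalls n
  closureCalls-poly = dim ⊗ (const 2 ⊕ dim ⊗ (const 2 ⊕ dim))

  checkCalls-poly : PolyBounded λ n ℓ _ → checkCalls n ℓ
  checkCalls-poly =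
    const 6 ⊕ (totalCalls-poly (const 1) ⊕ (dim ⊗ const 1 ⊕
      (closureCalls-poly ⊕ (dim ⊕ (totalCalls-poly len ⊕ dim ⊗ len)))))

  nodeCalls-poly : PolyBounded λ n ℓ _ → nodeCalls n ℓ
  nodeCalls-poly = const 5 ⊕ (dim ⊕ (dim ⊕ (const 4 ⊕ (checkCalls-poly ⊕
    (dim ⊕ (dim ⊗ (const 4 ⊕ (dim ⊕ dim ⊕ closureCalls-poly)) ⊕ checkCalls-poly))))))

  time-poly : ∀ s K → PolyBounded λ n ℓ N → s + K * suc (nodeCalls n ℓ * N)
  time-poly s K = const s ⊕ const K ⊗ (const 1 ⊕ nodeCalls-poly ⊗ scale)

-- Running the search on encoded instances

encList-tabulate : ∀ {A B : Set} (enc : A → Tree) (enc′ : B → Tree) {n} (f : Fin n → A) (g : Fin n → B) →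
  (∀ i → enc (f i) ≡ enc′ (g i)) → encList enc (List.tabulate f) ≡ encVec enc′ (tabulate g)
encList-tabulate enc enc′ {zero}  f g eq = refl
encList-tabulate enc enc′ {suc n} f g eq =
  cong₂ _∙_ (eq zero) (encList-tabulate enc enc′ (f ∘ suc) (g ∘ suc) (eq ∘ suc))

matrix : (G : InfluenceGraph) → let open InfluenceGraph G in Matrix order order
matrix G = tabulate λ u → tabulate (InfluenceGraph.weight G u)

encGraph≡encMatrix : ∀ G → encGraph G ≡ encMatrix (matrix G)
encGraph≡encMatrix G = 
  encList-tabulate _ (encVec (encMaybe encℚ)) id (λ u → tabulate (weight u)) λ u →
    encList-tabulate _ (encMaybe encℚ) id (weight u) λ v → refl
  where open InfluenceGraph G using (weight)

module _ (I : Instance) where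
  open Instance I
  open InfluenceGraph graph using (order)

  accepts : Subset order → Bool
  accepts = accept (matrix graph) targets (fromℕ budget) (ℚ.↥ bound) (fromℕ (ℚ.↧ₙ bound))

  decide : ℕ → Bool
  decide k = search accepts order k (+-identityʳ order) []

  encInstance≡ : encInstance I ≡
    encData (matrix graph) targets (fromℕ budget) (ℚ.↥ bound) (fromℕ (ℚ.↧ₙ bound))
  encInstance≡ = cong (_∙ (encSubset targets ∙ encℕ budget ∙ encℚ bound)) (encGraph≡encMatrix graph)

  decide-⇓ : ∀ k → (encInstance I ∙ encℕ k) ∷ [] ⊢ searchMain ⇓ encBool (decide k)
    # suc (searchCalls (nodeCalls order (bits (fromℕ (ℚ.↧ₙ bound)))) order k)
  decide-⇓ k rewrite encInstance≡ =
    case-∙ var (case-∙ var (call (var ∷ var ∷ var ∷ nil ∷ nil ∷ []) search′))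
    where
    rows : Matrix order order
    rows = matrix graph
    Result : ∀ m → m + 0 ≡ order → Set
    Result m eq =
      encMatrix rows
        ∷ encData rows targets (fromℕ budget) (ℚ.↥ bound) (fromℕ (ℚ.↧ₙ bound))
        ∷ encℕ k ∷ nil ∷ nil ∷ []
        ⊢ body searchF ⇓ encBool (search accepts m k eq [])
        # searchCalls (nodeCalls order (bits (fromℕ (ℚ.↧ₙ bound)))) m k
    search′ : Result order (+-identityʳ order)
    -- The clock is the encoded matrix, so the evaluation speaks of the length of its spine.
    -- Quantifying over the equation allows that length to be replaced by `order`.
    search′ = subst (λ m → ∀ eq → Result m eq) (spine-encVec _ rows)
      (λ eq → search-⇓ rows targets (fromℕ budget) (ℚ.↥ bound) (fromℕ (ℚ.↧ₙ bound))
        (fromℕ k) (encMatrix rows) k zero [] eq (sym (ℕᵇ.toℕ-fromℕ k)) z≤n)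
      (+-identityʳ order)

  -- The target set is encoded with one list entry per vertex. Strictness is wanted because the
  -- search bound is a power of `suc order`.
  order<size : order < size (encInstance I)
  order<size = s≤s (≤-trans (order≤ targets) (≤-trans (m≤m+n _ _) (≤-trans (n≤1+n _) (m≤n+m _ _))))
    where
    order≤ : ∀ {n} (X : Subset n) → n ≤ size (encSubset X)
    order≤ []      = z≤n
    order≤ (_ ∷ X) = s≤s (≤-trans (order≤ X) (m≤n+m _ _))

  bits<size : bits (fromℕ (ℚ.↧ₙ bound)) < size (encInstance I)
  bits<size = s≤s (≤-trans (bits≤ (fromℕ (ℚ.↧ₙ bound))) (≤-trans (m≤n+m _ (suc (size (encℤ (ℚ.↥ bound)))))
    (≤-trans (≤-trans (m≤n+m _ (suc (size (encℕ budget)))) (m≤n+m _ (suc (size (encSubset targets)))))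
      (m≤n+m _ (size (encGraph graph))))))
    where
    bits≤ : ∀ x → bits x ≤ size (encℕᵇ x)
    bits≤ zero     = z≤n
    bits≤ 2[1+ x ] = s≤s (≤-trans (bits≤ x) (m≤n+m _ _))
    bits≤ 1+[2 x ] = s≤s (≤-trans (bits≤ x) (m≤n+m _ _))

  2≤size : 2 ≤ size (encInstance I)
  2≤size = s≤s (≤-trans (s≤s z≤n) (m≤n+m (suc _) (size (encGraph graph))))

degree : (K : ℕ) → ℕ
degree K = proj₁ (Polynomial.time-poly (expSize searchMain) K)

-- From `suc m ^ suc k ≤ N * N ^ k` one factor `N` joins the polynomial part, so what depends on the
-- parameter is exactly `N ^ k`.
time-split : ∀ s K M m k {N} → 2 ≤ N → m < N →
  s + K * suc (searchCalls M m k) ≤ (s + K * suc (M * N)) * N ^ k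
time-split s K M m k {N} 2≤N m<N = begin
  s + K * suc (M * suc m ^ suc k)  ≤⟨ +-mono-≤ (s≤sP s) (*-monoʳ-≤ K (+-mono-≤ 1≤P
                                        (*-monoʳ-≤ M (^-monoˡ-≤ (suc k) m<N)))) ⟩
  s * P + K * (P + M * (N * P))    ≡⟨ lemma s K M N P ⟩
  (s + K * suc (M * N)) * P        ∎
  where
  open ≤-Reasoning
  P : ℕ
  P = N ^ k
  1≤P : 1 ≤ P
  1≤P = m^n>0 N {{>-nonZero (≤-trans (s≤s z≤n) 2≤N)}} k
  s≤sP : ∀ s → s ≤ s * P
  s≤sP s = ≤-trans (≤-reflexive (sym (*-identityʳ s))) (*-monoʳ-≤ s 1≤P)
  lemma : ∀ s K M N P → s * P + K * (P + M * (N * P)) ≡ (s + K * suc (M * N)) * P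
  lemma = solve-∀

module Running {K} (body-size : ∀ f → expSize (body f) ≤ K) where

  decide-time : ∀ I k → ∃[ t ] t ≤ size (encInstance I) ^ (degree K + k) ×
    program searchMain [ encInstance I ∙ encℕ k ]⇓ encBool (decide I k) ⟨ t ⟩
  decide-time I k with Timing.timed searchMain body-size (decide-⇓ I k)
  ... | t , t≤ , p = t , bound , p
    where
    N : ℕ
    N = size (encInstance I)
    n ℓ : ℕ
    n = InfluenceGraph.order (Instance.graph I)
    ℓ = bits (fromℕ (ℚ.↧ₙ (Instance.bound I)))
    open ≤-Reasoning
    bound : t ≤ N ^ (degree K + k)
    bound = begin
      t                        ≤⟨ t≤ ⟩
      _                        ≤⟨ time-split (expSize searchMain) K (nodeCalls n ℓ) n k (2≤size I) (order<size I) ⟩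
      _                        ≤⟨ *-monoˡ-≤ (N ^ k) (proj₂ (Polynomial.time-poly (expSize searchMain) K)
                                    (2≤size I) (<⇒≤ (order<size I)) (<⇒≤ (bits<size I))) ⟩
      N ^ degree K * N ^ k     ≡⟨ ^-distribˡ-+-* N (degree K) k ⟨
      N ^ (degree K + k)       ∎

  addMain-⇓ : ∀ c k → ∃[ t ] encℕ k ∷ [] ⊢ addMain c ⇓ encℕ (c + k) # t
  addMain-⇓ zero    k = 0 , var
  addMain-⇓ (suc c) k with addMain-⇓ c k
  ... | _ , p = _ , call (p ∷ []) (subst
    (λ x → encℕ (c + k) ∷ [] ⊢ body sucF ⇓ encℕᵇ x # bits (fromℕ (c + k)))
    (trans (cong ℕᵇ.suc (ℕᵇ.fromℕ≡fromℕ' (c + k))) (sym (ℕᵇ.fromℕ≡fromℕ' (suc (c + k)))))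
    (suc-⇓ (fromℕ (c + k))))

  add-computable : ∀ c → Computable λ k → c + k
  add-computable c = program (addMain c) , λ k →
    let t , _ , p = Timing.timed (addMain c) body-size (proj₂ (addMain-⇓ c k)) in t , p

-- Reachability and generating sets

addRow⁺ˡ : ∀ {n} {v : Fin n} {S} row → v ∈ S → v ∈ addRow S row
addRow⁺ˡ (_ ∷ row) here      = here
addRow⁺ˡ (_ ∷ row) (there p) = there (addRow⁺ˡ row p)

addRow⁺ʳ : ∀ {n} {v : Fin n} S row → T (is-just (lookup row v)) → v ∈ addRow S row
addRow⁺ʳ {v = zero}  (false ∷ S) (just _ ∷ row) _ = here
addRow⁺ʳ {v = zero}  (true ∷ S)  (just _ ∷ row) _ = here
addRow⁺ʳ {v = suc v} (_ ∷ S)     (_ ∷ row)      p = there (addRow⁺ʳ S row p)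

addRow⁻ : ∀ {n} {v : Fin n} S row → v ∈ addRow S row → v ∈ S ⊎ T (is-just (lookup row v))
addRow⁻ {v = zero}  (true ∷ S)  (_ ∷ row)      p = inj₁ here
addRow⁻ {v = zero}  (false ∷ S) (just _ ∷ row) p = inj₂ tt
addRow⁻ {v = suc v} (_ ∷ S)     (_ ∷ row)      (there p) with addRow⁻ S row p
... | inj₁ q = inj₁ (there q)
... | inj₂ q = inj₂ q

Arc : ∀ {m n} → Matrix m n → Fin m → Fin n → Set
Arc rows u v = T (is-just (lookup (lookup rows u) v))

spread⁺ˡ : ∀ {m n} {v : Fin n} (rows : Matrix m n) S {acc} → v ∈ acc → v ∈ spread rows S acc
spread⁺ˡ []           []          p = p
spread⁺ˡ (row ∷ rows) (false ∷ S) p = spread⁺ˡ rows S p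
spread⁺ˡ (row ∷ rows) (true ∷ S)  p = spread⁺ˡ rows S (addRow⁺ˡ row p)

spread⁺ʳ : ∀ {m n} {u v} (rows : Matrix m n) {S} acc → u ∈ S → Arc rows u v → v ∈ spread rows S acc
spread⁺ʳ (row ∷ rows) {_ ∷ S}     acc here      a = spread⁺ˡ rows S (addRow⁺ʳ acc row a)
spread⁺ʳ (row ∷ rows) {false ∷ S} acc (there p) a = spread⁺ʳ rows acc p a
spread⁺ʳ (row ∷ rows) {true ∷ S}  acc (there p) a = spread⁺ʳ rows (addRow acc row) p a

spread⁻ : ∀ {m n} {v} (rows : Matrix m n) S acc → v ∈ spread rows S acc →
          v ∈ acc ⊎ ∃[ u ] u ∈ S × Arc rows u v
spread⁻ []           []          acc p = inj₁ p
spread⁻ (row ∷ rows) (false ∷ S) acc p with spread⁻ rows S acc p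
... | inj₁ q           = inj₁ q
... | inj₂ (u , q , a) = inj₂ (suc u , there q , a)
spread⁻ (row ∷ rows) (true ∷ S)  acc p with spread⁻ rows S (addRow acc row) p
... | inj₂ (u , q , a) = inj₂ (suc u , there q , a)
... | inj₁ q with addRow⁻ acc row q
...   | inj₁ r = inj₁ r
...   | inj₂ a = inj₂ (zero , here , a)

getAt⁺ : ∀ {n} {v : Fin n} {S} → v ∈ S → T (getAt (toℕ v) S)
getAt⁺ here      = tt
getAt⁺ (there p) = getAt⁺ p

getAt⁻ : ∀ {n} (v : Fin n) S → T (getAt (toℕ v) S) → v ∈ S
getAt⁻ zero    (true ∷ S) _ = here
getAt⁻ (suc v) (_ ∷ S)    p = there (getAt⁻ v S p)

delAt⊆ : ∀ {n} i (S : Subset n) → delAt i S ⊆ S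
delAt⊆ zero    (_ ∷ S) (there p) = there p
delAt⊆ (suc i) (_ ∷ S) here      = here
delAt⊆ (suc i) (_ ∷ S) (there p) = there (delAt⊆ i S p)

delAt⁺ : ∀ {n} i {S : Subset n} {v} → v ∈ S → toℕ v ≢ i → v ∈ delAt i S
delAt⁺ zero    here      v≢i = contradiction refl v≢i
delAt⁺ zero    (there p) v≢i = there p
delAt⁺ (suc i) here      v≢i = here
delAt⁺ (suc i) (there p) v≢i = there (delAt⁺ i p (v≢i ∘ cong suc))

delAt⁻ : ∀ {n} {v : Fin n} S → v ∉ delAt (toℕ v) S
delAt⁻ {v = suc v} (_ ∷ S) (there p) = delAt⁻ S p

∣p∪q∣≤∣p∣+∣q∣ : ∀ {n} (p q : Subset n) → ∣ p ∪ q ∣ ≤ ∣ p ∣ + ∣ q ∣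
∣p∪q∣≤∣p∣+∣q∣ []          []          = z≤n
∣p∪q∣≤∣p∣+∣q∣ (true ∷ p)  (true ∷ q)  = s≤s (≤-trans (∣p∪q∣≤∣p∣+∣q∣ p q) (+-monoʳ-≤ ∣ p ∣ (n≤1+n _)))
∣p∪q∣≤∣p∣+∣q∣ (true ∷ p)  (false ∷ q) = s≤s (∣p∪q∣≤∣p∣+∣q∣ p q)
∣p∪q∣≤∣p∣+∣q∣ (false ∷ p) (true ∷ q)  =
  ≤-trans (s≤s (∣p∪q∣≤∣p∣+∣q∣ p q)) (≤-reflexive (sym (+-suc ∣ p ∣ ∣ q ∣)))
∣p∪q∣≤∣p∣+∣q∣ (false ∷ p) (false ∷ q) = ∣p∪q∣≤∣p∣+∣q∣ p q

-- A relation replaces the injection because partners are known to exist only for members of `Y`.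
-- The partner of the first member is removed from `X`; injectivity ensures that no later member is
-- paired with it.
card-injection : ∀ {m n} (Y : Subset m) (X : Subset n) (R : Fin m → Fin n → Set) →
  (∀ {y} → y ∈ Y → ∃[ x ] x ∈ X × R y x) →
  (∀ {y y′ x} → y ∈ Y → y′ ∈ Y → R y x → R y′ x → y ≡ y′) → ∣ Y ∣ ≤ ∣ X ∣
card-injection []          X R f inj = z≤n
card-injection (false ∷ Y) X R f inj =
  card-injection Y X (R ∘ suc) (f ∘ there)
    λ p q r r′ → Fin.suc-injective (inj (there p) (there q) r r′)
card-injection (true ∷ Y)  X R f inj with f here
... | x , x∈X , r = ≤-trans (s≤s rest) (x∈p⇒∣p-x∣<∣p∣ x∈X)
  where
  f′ : ∀ {y} → y ∈ Y → ∃[ x′ ] x′ ∈ X - x × R (suc y) x′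
  f′ p with f (there p)
  ... | x′ , x′∈X , r′ = x′ , x∈p∧x≢y⇒x∈p-y x′∈X (λ { refl → zero≢suc (inj here (there p) r r′) }) , r′
    where
    zero≢suc : ∀ {n} {i : Fin n} → _≢_ {A = Fin (suc n)} zero (suc i)
    zero≢suc ()
  rest : ∣ Y ∣ ≤ ∣ X - x ∣
  rest = card-injection Y (X - x) (R ∘ suc) f′
    λ p q r r′ → Fin.suc-injective (inj (there p) (there q) r r′)

-- `X′` collects one witness for each member of `A`; witnesses may coincide, so its size is only
-- bounded.
select : ∀ {m n} (A : Subset m) (X : Subset n) (R : Fin m → Fin n → Set) →
  (∀ {v} → v ∈ A → ∃[ x ] x ∈ X × R v x) →
  ∃[ X′ ] X′ ⊆ X × ∣ X′ ∣ ≤ ∣ A ∣ × (∀ {v} → v ∈ A → ∃[ x ] x ∈ X′ × R v x)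
select {n = n} []          X R f = ∅ , ⊥⊆ , ≤-reflexive (∣⊥∣≡0 n) , λ ()
select         (false ∷ A) X R f with select A X (R ∘ suc) (f ∘ there)
... | X′ , X′⊆X , ≤A , g = X′ , X′⊆X , ≤A , λ { (there p) → g p }
select         (true ∷ A)  X R f with select A X (R ∘ suc) (f ∘ there) | f here
... | X′ , X′⊆X , ≤A , g | x , x∈X , r = ⁅ x ⁆ ∪ X′ , ⊆X , ≤1+A , g′
  where
  ⊆X : ⁅ x ⁆ ∪ X′ ⊆ X
  ⊆X p with x∈p∪q⁻ ⁅ x ⁆ X′ p
  ... | inj₁ q = subst (_∈ X) (sym (x∈⁅y⁆⇒x≡y x q)) x∈X
  ... | inj₂ q = X′⊆X q
  ≤1+A : ∣ ⁅ x ⁆ ∪ X′ ∣ ≤ suc ∣ A ∣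
  ≤1+A = ≤-trans (∣p∪q∣≤∣p∣+∣q∣ ⁅ x ⁆ X′) (+-mono-≤ (≤-reflexive (∣⁅x⁆∣≡1 x)) ≤A)
  g′ : ∀ {v} → v ∈ true ∷ A → ∃[ x′ ] x′ ∈ ⁅ x ⁆ ∪ X′ × R v x′
  g′ here      = x , x∈p∪q⁺ (inj₁ (x∈⁅x⁆ x)) , r
  g′ (there p) with g p
  ... | x′ , q , r′ = x′ , x∈p∪q⁺ (inj₂ q) , r′

module Reachability {n} (rows : Matrix n n) where

  Closed : Subset n → Set
  Closed S = ∀ {u v} → u ∈ S → Arc rows u v → v ∈ S

  iterate-extensive : ∀ k {S} → S ⊆ iterate k rows S
  iterate-extensive zero    p = p
  iterate-extensive (suc k) {S} p = iterate-extensive k (spread⁺ˡ rows S p)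

  iterate-least : ∀ k {S} {P : Fin n → Set} → (∀ {v} → v ∈ S → P v) →
    (∀ {u v} → P u → Arc rows u v → P v) → ∀ {v} → v ∈ iterate k rows S → P v
  iterate-least zero    base step = base
  iterate-least (suc k) {S} {P} base step = iterate-least k base′ step
    where
    base′ : ∀ {v} → v ∈ spread rows S S → P v
    base′ p with spread⁻ rows S S p
    ... | inj₁ q           = base q
    ... | inj₂ (u , q , a) = step (base q) a

  closed-iterate : ∀ k {S} → Closed S → Closed (iterate k rows S)
  closed-iterate k closed p a = iterate-extensive k (closed (iterate-least k id closed p) a)

  -- A round that adds nothing reveals a closed set, which later rounds preserve; otherwise each
  -- round adds a vertex. For `k = n` the second alternative forces the full set, which is closed
  -- too.
  iterate-grows : ∀ k S → Closed (iterate k rows S) ⊎ k + ∣ S ∣ ≤ ∣ iterate k rows S ∣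
  iterate-grows zero    S = inj₂ ≤-refl
  iterate-grows (suc k) S with S ⊂? spread rows S S
  ... | no S⊄ = inj₁ (closed-iterate (suc k) closed)
    where
    closed : Closed S
    closed {v = v} p a with v ∈? S
    ... | yes q = q
    ... | no ¬q = ⊥-elim (S⊄ (spread⁺ˡ rows S , v , spread⁺ʳ rows S p a , ¬q))
  ... | yes S⊂ with iterate-grows k (spread rows S S)
  ...   | inj₁ closed = inj₁ closed
  ...   | inj₂ k+ = inj₂ (≤-trans (≤-reflexive (sym (+-suc k _))) (≤-trans (+-monoʳ-≤ k (p⊂q⇒∣p∣<∣q∣ S⊂)) k+))

  cl : Subset n → Subset n
  cl = closure rows

  cl-extensive : ∀ {S} → S ⊆ cl S
  cl-extensive = iterate-extensive n

  cl-least : ∀ {S} {P : Fin n → Set} → (∀ {v} → v ∈ S → P v) →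
    (∀ {u v} → P u → Arc rows u v → P v) → ∀ {v} → v ∈ cl S → P v
  cl-least = iterate-least n

  cl-closed : ∀ S → Closed (cl S)
  cl-closed S with iterate-grows n S
  ... | inj₁ closed = closed
  ... | inj₂ n+ = λ _ _ → subst (_ ∈_) (sym full) ∈⊤
    where
    full : cl S ≡ _
    full = ∣p∣≡n⇒p≡⊤ (≤-antisym (∣p∣≤n (cl S)) (≤-trans (m≤m+n n _) n+))

  cl-minimal : ∀ {S S′} → S ⊆ cl S′ → cl S ⊆ cl S′
  cl-minimal {S′ = S′} S⊆ = cl-least S⊆ (cl-closed S′)

  cl-mono : ∀ {S S′} → S ⊆ S′ → cl S ⊆ cl S′
  cl-mono S⊆ = cl-minimal (cl-extensive ∘ S⊆)

  -- An arc has a single tail, so one source suffices to reach a vertex. This property of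
  -- reachability, absent from general closure operators, later pairs generators with members of
  -- `X`.
  cl-point : ∀ {S v} → v ∈ cl S → ∃[ x ] x ∈ S × v ∈ cl ⁅ x ⁆
  cl-point {S} = cl-least {P = λ v → ∃[ x ] x ∈ S × v ∈ cl ⁅ x ⁆}
    (λ {v} p → v , p , cl-extensive (x∈⁅x⁆ v))
    (λ { (x , x∈S , p) a → x , x∈S , cl-closed ⁅ x ⁆ p a })

  prune⊆ : ∀ i {X} → prune rows i X ⊆ X
  prune⊆ zero    p = p
  prune⊆ (suc i) {X} with getAt i (cl (delAt i X))
  ... | true  = delAt⊆ i X ∘ prune⊆ i
  ... | false = prune⊆ i

  prune-generates : ∀ i {X} → X ⊆ cl (prune rows i X)
  prune-generates zero    = cl-extensive
  prune-generates (suc i) {X} with getAt i (cl (delAt i X)) in eq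
  ... | false = prune-generates i
  ... | true  = λ p → cl-minimal (prune-generates i) (X⊆ p)
    where
    X⊆ : X ⊆ cl (delAt i X)
    X⊆ {v} p with toℕ v ≟ i
    ... | yes refl = getAt⁻ v _ (Equivalence.from T-≡ eq)
    ... | no v≢i   = cl-extensive (delAt⁺ i p v≢i)

  -- When the turn of `v` came, it was kept because the other vertices then present did not generate
  -- it. Everything kept in the end was present at that time, so `Y` lies among those others and
  -- monotonicity applies.
  prune-irredundant : ∀ i {X Y v} → toℕ v < i → v ∈ prune rows i X → Y ⊆ prune rows i X → v ∉ Y → v ∉ cl Y
  prune-irredundant (suc i) {X} {Y} {v} v≤i v∈ Y⊆ v∉Y with getAt i (cl (delAt i X)) in eq | m≤n⇒m<n∨m≡n (s≤s⁻¹ v≤i)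
  ... | true  | inj₁ v<i  = prune-irredundant i v<i v∈ Y⊆ v∉Y
  ... | false | inj₁ v<i  = prune-irredundant i v<i v∈ Y⊆ v∉Y
  ... | true  | inj₂ refl = contradiction (prune⊆ i v∈) (delAt⁻ X)
  ... | false | inj₂ refl = λ v∈cl → subst T eq (getAt⁺ (cl-mono Y⊆′ v∈cl))
    where
    Y⊆′ : Y ⊆ delAt i X
    Y⊆′ {w} w∈Y = delAt⁺ i (prune⊆ i (Y⊆ w∈Y)) λ w≡v → v∉Y (subst (_∈ Y) (Fin.toℕ-injective w≡v) w∈Y)

  -- Irredundant generators lie in distinct source components, and every
  -- generating set meets each source component.
  prune-minimum : ∀ X → ∣ prune rows n (cl X) ∣ ≤ ∣ X ∣
  prune-minimum X = card-injection Y X (λ y x → y ∈ cl ⁅ x ⁆ × x ∈ cl ⁅ y ⁆) partner partner-unique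
    where
    Y : Subset n
    Y = prune rows n (cl X)
    unique : ∀ {y y′} → y ∈ Y → y′ ∈ Y → y ∈ cl ⁅ y′ ⁆ → y ≡ y′
    unique {y} {y′} y∈ y′∈ y∈cl with y Fin.≟ y′
    ... | yes y≡y′ = y≡y′
    ... | no y≢y′  = contradiction y∈cl (prune-irredundant n (Fin.toℕ<n y) y∈
      (λ p → subst (_∈ Y) (sym (x∈⁅y⁆⇒x≡y y′ p)) y′∈) (y≢y′ ∘ x∈⁅y⁆⇒x≡y y′))
    through : ∀ {x y} → x ∈ cl ⁅ y ⁆ → cl ⁅ x ⁆ ⊆ cl ⁅ y ⁆
    through {x} {y} p = cl-minimal λ q → subst (_∈ cl ⁅ y ⁆) (sym (x∈⁅y⁆⇒x≡y x q)) p
    -- Some `x` in `X` reaches `y`, and some generator `y′` reaches `x`, hence also `y`.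
    -- Irredundancy forces `y′ = y`, so `x` and `y` reach each other.
    partner : ∀ {y} → y ∈ Y → ∃[ x ] x ∈ X × y ∈ cl ⁅ x ⁆ × x ∈ cl ⁅ y ⁆
    partner {y} y∈ with cl-point (prune⊆ n y∈)
    ... | x , x∈X , y∈cl with cl-point (prune-generates n (cl-extensive x∈X))
    ...   | y′ , y′∈ , x∈cl = x , x∈X , y∈cl ,
      subst (λ y → x ∈ cl ⁅ y ⁆) (sym (unique y∈ y′∈ (through x∈cl y∈cl))) x∈cl
    partner-unique : ∀ {y y′ x} → y ∈ Y → y′ ∈ Y →
      y ∈ cl ⁅ x ⁆ × x ∈ cl ⁅ y ⁆ → y′ ∈ cl ⁅ x ⁆ × x ∈ cl ⁅ y′ ⁆ → y ≡ y′
    partner-unique y∈ y′∈ (y←x , _) (_ , x←y′) = unique y∈ y′∈ (through x←y′ y←x)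

-- Symmetric differences

△⁺ˡ : ∀ {n} {v : Fin n} {A S} → v ∈ A → v ∉ S → v ∈ A △ S
△⁺ˡ {S = true ∷ _}  here      v∉S = contradiction here v∉S
△⁺ˡ {S = false ∷ _} here      v∉S = here
△⁺ˡ {S = _ ∷ _}     (there p) v∉S = there (△⁺ˡ p (v∉S ∘ there))

△⁺ʳ : ∀ {n} {v : Fin n} {A S} → v ∉ A → v ∈ S → v ∈ A △ S
△⁺ʳ {A = true ∷ _}  v∉A here      = contradiction here v∉A
△⁺ʳ {A = false ∷ _} v∉A here      = here
△⁺ʳ {A = _ ∷ _}     v∉A (there p) = there (△⁺ʳ (v∉A ∘ there) p)

△⁻ : ∀ {n} {v : Fin n} A S → v ∈ A △ S → (v ∈ A × v ∉ S) ⊎ (v ∉ A × v ∈ S)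
△⁻ (true ∷ A)  (false ∷ S) here = inj₁ (here , λ ())
△⁻ (false ∷ A) (true ∷ S)  here = inj₂ ((λ ()) , here)
△⁻ (a ∷ A)     (s ∷ S)     (there p) with △⁻ A S p
... | inj₁ (p , q) = inj₁ (there p , λ { (there r) → q r })
... | inj₂ (p , q) = inj₂ ((λ { (there r) → p r }) , there q)

△-involutive : ∀ {n} (A S : Subset n) → A △ (A △ S) ≡ S
△-involutive []          []          = refl
△-involutive (false ∷ A) (s ∷ S)     = cong (s ∷_) (△-involutive A S)
△-involutive (true ∷ A)  (false ∷ S) = cong (false ∷_) (△-involutive A S)
△-involutive (true ∷ A)  (true ∷ S)  = cong (true ∷_) (△-involutive A S)

toℕ-total : ∀ {n} (X : Subset n) d → ℕᵇ.toℕ (total X d) ≡ ∣ X ∣ * ℕᵇ.toℕ d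
toℕ-total []          d = refl
toℕ-total (false ∷ X) d = toℕ-total X d
toℕ-total (true ∷ X)  d = trans (ℕᵇ.toℕ-homo-+ d (total X d)) (cong (λ t → ℕᵇ.toℕ d + t) (toℕ-total X d))

-- Soundness and completeness of the subset search

if-true⁻ : ∀ {b x} → T (if b then true else x) → T b ⊎ T x
if-true⁻ {true}  p = inj₁ tt
if-true⁻ {false} p = inj₂ p

if-true⁺ : ∀ {b x} → T b ⊎ T x → T (if b then true else x)
if-true⁺ {true}  _        = tt
if-true⁺ {false} (inj₂ p) = p

search-sound : ∀ {n j} (accept : Subset n → Bool) m r (eq : m + j ≡ n) D →
  T (search accept m r eq D) → ∃[ D′ ] T (accept D′)
search-sound accept zero    r       refl D p = D , p
search-sound accept (suc m) zero    eq   D p = search-sound accept m zero _ (false ∷ D) p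
search-sound accept (suc m) (suc r) eq   D p with if-true⁻ {search accept m (suc r) _ (false ∷ D)} p
... | inj₁ q = search-sound accept m (suc r) _ (false ∷ D) q
... | inj₂ q = search-sound accept m r _ (true ∷ D) q

-- The leaf that the search reaches from `D` if the remaining decisions are those of `E` in order;
-- consing them reverses `E`.
rev-onto : ∀ {n m j} → Subset m → m + j ≡ n → Subset j → Subset n
rev-onto []                refl D = D
rev-onto {m = suc m} (x ∷ E) eq D = rev-onto E (trans (+-suc m _) eq) (x ∷ D)

∣rev-onto∣ : ∀ {n m j} (E : Subset m) (eq : m + j ≡ n) D → ∣ rev-onto E eq D ∣ ≡ ∣ E ∣ + ∣ D ∣
∣rev-onto∣ []          refl D = refl
∣rev-onto∣ (true ∷ E)  eq   D = trans (∣rev-onto∣ E _ (true ∷ D)) (+-suc _ _)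
∣rev-onto∣ (false ∷ E) eq   D = ∣rev-onto∣ E _ (false ∷ D)

rev-onto-surjective : ∀ {n} m {j} (eq : m + j ≡ n) X → ∃[ E ] ∃[ D ] rev-onto {m = m} {j} E eq D ≡ X
rev-onto-surjective zero    refl X = [] , X , refl
rev-onto-surjective (suc m) eq   X with rev-onto-surjective m (trans (+-suc m _) eq) X
... | E , x ∷ D , eq′ = x ∷ E , D , eq′

search-complete : ∀ {n m j} (accept : Subset n → Bool) r (E : Subset m) (eq : m + j ≡ n) D →
  ∣ E ∣ ≤ r → T (accept (rev-onto E eq D)) → T (search accept m r eq D)
search-complete accept r       []          refl D _       p = p
search-complete accept zero    (false ∷ E) eq   D ≤r      p = search-complete accept zero E _ (false ∷ D) ≤r p
search-complete accept (suc r) (false ∷ E) eq   D ≤r      p =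
  if-true⁺ (inj₁ (search-complete accept (suc r) E _ (false ∷ D) ≤r p))
search-complete {m = suc m} accept (suc r) (true ∷ E)  eq   D (s≤s ≤r) p =
  if-true⁺ {search accept m (suc r) _ (false ∷ D)} (inj₂ (search-complete accept r E _ (true ∷ D) ≤r p))

search-finds : ∀ {n} (accept : Subset n → Bool) k X (eq : n + 0 ≡ n) → ∣ X ∣ ≤ k →
  T (accept X) → T (search accept n k eq [])
search-finds {n} accept k X eq ≤k p with rev-onto-surjective n eq X
... | E , [] , refl = search-complete accept k E eq []
  (≤-trans (≤-reflexive (trans (sym (+-identityʳ _)) (sym (∣rev-onto∣ E eq [])))) ≤k) p

-- The cascade without probabilistic arcs

𝔼 : ∀ {A : Set} → (A → ℚ) → Dist A → ℚ
𝔼 g []            = 0ℚ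
𝔼 g ((p , x) ∷ d) = p ℚ.* g x ℚ.+ 𝔼 g d

𝔼-++ : ∀ {A : Set} (g : A → ℚ) d d′ → 𝔼 g (d List.++ d′) ≡ 𝔼 g d ℚ.+ 𝔼 g d′
𝔼-++ g []            d′ = sym (ℚ.+-identityˡ _)
𝔼-++ g ((p , x) ∷ d) d′ = trans (cong (p ℚ.* g x ℚ.+_) (𝔼-++ g d d′)) (sym (ℚ.+-assoc (p ℚ.* g x) _ _))

𝔼-scale : ∀ {A : Set} (g : A → ℚ) p d → 𝔼 g (map (λ (q , y) → p ℚ.* q , y) d) ≡ p ℚ.* 𝔼 g d
𝔼-scale g p []            = sym (ℚ.*-zeroʳ p)
𝔼-scale g p ((q , x) ∷ d) = trans (cong₂ ℚ._+_ (ℚ.*-assoc p q (g x)) (𝔼-scale g p d))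
  (sym (ℚ.*-distribˡ-+ p (q ℚ.* g x) (𝔼 g d)))

𝔼->>= : ∀ {A B : Set} (g : B → ℚ) d (k : A → Dist B) → 𝔼 g (d >>= k) ≡ 𝔼 (λ x → 𝔼 g (k x)) d
𝔼->>= g []            k = refl
𝔼->>= g ((p , x) ∷ d) k = trans (𝔼-++ g (map (λ (q , y) → p ℚ.* q , y) (k x)) (d >>= k))
  (cong₂ ℚ._+_ (𝔼-scale g p (k x)) (𝔼->>= g d k))

indicator : Bool → ℚ
indicator b = if b then 1ℚ else 0ℚ

Pr≡𝔼 : ∀ {A : Set} {P : A → Set} (P? : ∀ x → Dec (P x)) d → Pr P? d ≡ 𝔼 (indicator ∘ does ∘ P?) d
Pr≡𝔼 P? []            = refl
Pr≡𝔼 P? ((p , x) ∷ d) with does (P? x)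
... | true  = cong₂ ℚ._+_ (sym (ℚ.*-identityʳ p)) (Pr≡𝔼 P? d)
... | false = trans (Pr≡𝔼 P? d) (sym (trans (cong (ℚ._+ 𝔼 _ d) (ℚ.*-zeroʳ p)) (ℚ.+-identityˡ _)))

-- A distribution lists outcomes with multiplicity and possibly with
-- probability 0, so "d is the point mass at x" is expressed by its
-- expectations.
Concentrated : ∀ {A : Set} → Dist A → A → Set
Concentrated {A} d x = ∀ (g : A → ℚ) → 𝔼 g d ≡ g x

concentrated-return : ∀ {A : Set} (x : A) → Concentrated (return x) x
concentrated-return x g = trans (ℚ.+-identityʳ _) (ℚ.*-identityˡ (g x))

-- Concentration of `d` is applied to the function `λ x → 𝔼 g (k x)`, so the continuation is
-- examined at `x` alone and the outcomes listed with probability 0 drop out.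
concentrated->>= : ∀ {A B : Set} (d : Dist A) (k : A → Dist B) {x y} →
  Concentrated d x → Concentrated (k x) y → Concentrated (d >>= k) y
concentrated->>= d k c c′ g = trans (𝔼->>= g d k) (trans (c (λ x → 𝔼 g (k x))) (c′ g))

concentrated-bernoulli : Concentrated (bernoulli 1ℚ) true
concentrated-bernoulli g = trans
  (cong₂ ℚ._+_ (ℚ.*-identityˡ (g true)) (trans (ℚ.+-identityʳ _) (ℚ.*-zeroˡ (g false))))
  (ℚ.+-identityʳ (g true))

mapMaybe-∈⁺ : ∀ {A B : Set} (f : A → Maybe B) {xs x y} → x List.∈ xs → f x ≡ just y → y List.∈ mapMaybe f xs
mapMaybe-∈⁺ f {x ∷ xs} (here refl) eq with f x
mapMaybe-∈⁺ f {x ∷ xs} (here refl) refl | just y = here refl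
mapMaybe-∈⁺ f {x ∷ xs} (there p)   eq with f x
... | just _  = there (mapMaybe-∈⁺ f p eq)
... | nothing = mapMaybe-∈⁺ f p eq

mapMaybe-∈⁻ : ∀ {A B : Set} (f : A → Maybe B) xs {y} → y List.∈ mapMaybe f xs → ∃[ x ] f x ≡ just y
mapMaybe-∈⁻ f (x ∷ xs) p with f x in eq
mapMaybe-∈⁻ f (x ∷ xs) p           | nothing = mapMaybe-∈⁻ f xs p
mapMaybe-∈⁻ f (x ∷ xs) (here refl) | just _  = x , eq
mapMaybe-∈⁻ f (x ∷ xs) (there p)   | just _  = mapMaybe-∈⁻ f xs p

does-∈? : ∀ {n} (v : Fin n) S → does (v ∈? S) ≡ lookup S v
does-∈? zero    (true ∷ S)  = refl
does-∈? zero    (false ∷ S) = refl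
does-∈? (suc v) (_ ∷ S)     = does-∈? v S

-- Given by explicit numerator and denominator, unlike `+ c / 1`, so that an inequality of rationals
-- unfolds directly to one of integers.
fromℕℚ : ℕ → ℚ
fromℕℚ c = ℚ.mkℚ (+ c) 0 (Coprime.sym (Coprime.1-coprimeTo c))

1+fromℕℚ : ∀ c → 1ℚ ℚ.+ fromℕℚ c ≡ fromℕℚ (suc c)
1+fromℕℚ c = trans (ℚ./-cong {q₁ = 1} (cong (λ z → + 1 ℤ.+ z) (ℤ.*-identityʳ (+ c))) refl) (ℚ.↥p/↧p≡p (fromℕℚ (suc c)))

sum-indicator : ∀ {n} (S : Subset n) → sum (indicator ∘ lookup S) ≡ fromℕℚ ∣ S ∣
sum-indicator []          = refl
sum-indicator (true ∷ S)  = trans (cong (1ℚ ℚ.+_) (sum-indicator S)) (1+fromℕℚ ∣ S ∣)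
sum-indicator (false ∷ S) = trans (ℚ.+-identityˡ _) (sum-indicator S)

module DeterministicCascade (G : InfluenceGraph) (r≡0 : InfluenceGraph.#probabilistic G ≡ 0) where
  open InfluenceGraph G
  open Cascade G
  open Reachability (matrix G) using (cl)

  arc-weight : ∀ {u v q} → (u , v , q) List.∈ arcs → weight u v ≡ just q
  arc-weight p with mapMaybe-∈⁻ _ (cartesianProduct (allFin order) (allFin order)) p
  ... | (u , v) , eq with weight u v in w≡ | eq
  ...   | just q | refl = w≡

  weight-arc : ∀ {u v q} → weight u v ≡ just q → (u , v , q) List.∈ arcs
  weight-arc {u} {v} w≡ = mapMaybe-∈⁺ _ (List.∈-cartesianProduct⁺ (List.∈-allFin u) (List.∈-allFin v))
    (cong (Maybe.map λ q → u , v , q) w≡)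

  certain : ∀ {u v q} → (u , v , q) List.∈ arcs → q ≡ 1ℚ
  certain {u} {v} {q} p with q ℚ.<? 1ℚ
  ... | no q≮1  = ℚ.≤-antisym (proj₂ (range (arc-weight p))) (ℚ.≮⇒≥ q≮1)
  ... | yes q<1 = contradiction (trans (sym r≡0) (cong length none)) λ ()
    where
    none : filter (λ (_ , _ , q) → q ℚ.<? 1ℚ) arcs ≡ _ ∷ _
    none = proj₂ (proj₂ (nonempty (List.∈-filter⁺ (λ (_ , _ , q) → q ℚ.<? 1ℚ) p q<1)))
      where
      nonempty : ∀ {A : Set} {x : A} {xs} → x List.∈ xs → ∃[ y ] ∃[ ys ] xs ≡ y ∷ ys
      nonempty {xs = y ∷ ys} _ = y , ys , refl

  Arc⁺ : ∀ {u v q} → weight u v ≡ just q → Arc (matrix G) u v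
  Arc⁺ {u} {v} w≡ rewrite Vec.lookup∘tabulate (λ u → tabulate (weight u)) u
                        | Vec.lookup∘tabulate (weight u) v | w≡ = tt

  Arc⁻ : ∀ {u v} → Arc (matrix G) u v → ∃[ q ] weight u v ≡ just q
  Arc⁻ {u} {v} a rewrite Vec.lookup∘tabulate (λ u → tabulate (weight u)) u
                       | Vec.lookup∘tabulate (weight u) v with weight u v
  ... | just q = q , refl

  heads : List (V × V × ℚ) → Subset order
  heads = foldr (λ (_ , v , _) N → ⁅ v ⁆ ∪ N) ∅

  heads⁺ : ∀ {u v q as} → (u , v , q) List.∈ as → v ∈ heads as
  heads⁺ {v = v} (here refl) = x∈p∪q⁺ (inj₁ (x∈⁅x⁆ v))
  heads⁺         (there p)   = x∈p∪q⁺ (inj₂ (heads⁺ p))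

  heads⁻ : ∀ {v} as → v ∈ heads as → ∃[ u ] ∃[ q ] (u , v , q) List.∈ as
  heads⁻ []                p = contradiction p ∉⊥
  heads⁻ ((u , w , q) ∷ as) p with x∈p∪q⁻ ⁅ w ⁆ (heads as) p
  ... | inj₁ r with refl ← x∈⁅y⁆⇒x≡y w r = u , q , here refl
  ... | inj₂ r with u′ , q′ , r′ ← heads⁻ as r = u′ , q′ , there r′

  try-concentrated : ∀ as → (∀ {u v q} → (u , v , q) List.∈ as → q ≡ 1ℚ) → Concentrated (try as) (heads as)
  try-concentrated []                 _       = concentrated-return ∅
  try-concentrated ((_ , v , _) ∷ as) certain with refl ← certain (here refl) =
    concentrated->>= (bernoulli 1ℚ) (λ success → try as >>= λ N → return (if success then ⁅ v ⁆ ∪ N else N))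
      concentrated-bernoulli
      (concentrated->>= (try as) (λ N → return (⁅ v ⁆ ∪ N)) (try-concentrated as (certain ∘ there))
        (concentrated-return (⁅ v ⁆ ∪ heads as)))

  next : Subset order → Subset order → Subset order
  next S N = heads (attempts ⟨ S , N ⟩)

  attempt? : ∀ S N ((u , v , _) : V × V × ℚ) → Dec (u ∈ N × v ∉ S)
  attempt? S N (u , v , _) = u ∈? N ×-dec ¬? (v ∈? S)

  next⁺ : ∀ {S N u v} → u ∈ N → v ∉ S → Arc (matrix G) u v → v ∈ next S N
  next⁺ {S} {N} u∈N v∉S a with q , w≡ ← Arc⁻ a =
    heads⁺ (List.∈-filter⁺ (attempt? S N) (weight-arc w≡) (u∈N , v∉S))

  next⁻ : ∀ {v} S N → v ∈ next S N → ∃[ u ] u ∈ N × Arc (matrix G) u v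
  next⁻ S N p with u , q , r ← heads⁻ (attempts ⟨ S , N ⟩) p
              with r′ , u∈N , _ ← List.∈-filter⁻ (attempt? S N) {xs = arcs} r = u , u∈N , Arc⁺ (arc-weight r′)

  step-concentrated : ∀ S N → Concentrated (step ⟨ S , N ⟩) ⟨ S ∪ next S N , next S N ⟩
  step-concentrated S N = concentrated->>= (try (attempts ⟨ S , N ⟩)) (λ N′ → return ⟨ S ∪ N′ , N′ ⟩)
    (try-concentrated (attempts ⟨ S , N ⟩) (certain ∘ proj₁ ∘ List.∈-filter⁻ (attempt? S N) {xs = arcs}))
    (concentrated-return ⟨ S ∪ next S N , next S N ⟩)

  -- Vertices that are active but not new have used their chance, and all their arcs succeeded. So
  -- attempts from `N` alone have the same effect as following all arcs out of `S`.
  Reachable-state : Subset order → Subset order → Set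
  Reachable-state S N = N ⊆ S × (∀ {u v} → u ∈ S → u ∉ N → Arc (matrix G) u v → v ∈ S)

  spread≡ : ∀ {S N} → Reachable-state S N → S ∪ next S N ≡ spread (matrix G) S S
  spread≡ {S} {N} (N⊆S , old) = ⊆-antisym to from
    where
    to : S ∪ next S N ⊆ spread (matrix G) S S
    to p with x∈p∪q⁻ S (next S N) p
    ... | inj₁ q = spread⁺ˡ (matrix G) S q
    ... | inj₂ q with u , u∈N , a ← next⁻ S N q = spread⁺ʳ (matrix G) S (N⊆S u∈N) a
    from : spread (matrix G) S S ⊆ S ∪ next S N
    from {v} p with spread⁻ (matrix G) S S p
    ... | inj₁ q = x∈p∪q⁺ (inj₁ q)
    ... | inj₂ (u , u∈S , a) with v ∈? S | u ∈? N
    ...   | yes v∈S | _       = x∈p∪q⁺ (inj₁ v∈S)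
    ...   | no v∉S  | yes u∈N = x∈p∪q⁺ (inj₂ (next⁺ u∈N v∉S a))
    ...   | no v∉S  | no u∉N  = contradiction (old u∈S u∉N a) v∉S

  step-invariant : ∀ {S N} → Reachable-state S N → Reachable-state (S ∪ next S N) (next S N)
  step-invariant {S} {N} (N⊆S , old) = q⊆p∪q S (next S N) , old′
    where
    old′ : ∀ {u v} → u ∈ S ∪ next S N → u ∉ next S N → Arc (matrix G) u v → v ∈ S ∪ next S N
    old′ {u} {v} u∈ u∉ a with x∈p∪q⁻ S (next S N) u∈ | v ∈? S | u ∈? N
    ... | inj₂ u∈N′ | _       | _       = contradiction u∈N′ u∉
    ... | inj₁ _    | yes v∈S | _       = x∈p∪q⁺ (inj₁ v∈S)
    ... | inj₁ _    | no v∉S  | yes u∈N = x∈p∪q⁺ (inj₂ (next⁺ u∈N v∉S a))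
    ... | inj₁ u∈S  | no v∉S  | no u∉N  = contradiction (old u∈S u∉N a) v∉S

  -- Cascade and closure perform the same number of rounds, so they are compared round by round
  -- rather than at termination.
  run-concentrated : ∀ k {S N} → Reachable-state S N →
    ∃[ N′ ] Concentrated (run k ⟨ S , N ⟩) ⟨ iterate k (matrix G) S , N′ ⟩
  run-concentrated zero    {S} {N} _   = N , concentrated-return ⟨ S , N ⟩
  run-concentrated (suc k) {S} {N} inv with run-concentrated k (step-invariant inv)
  ... | N′ , c = N′ , subst (λ S′ → Concentrated (run (suc k) ⟨ S , N ⟩) ⟨ iterate k (matrix G) S′ , N′ ⟩)
    (spread≡ inv) (concentrated->>= (step ⟨ S , N ⟩) (run k) (step-concentrated S N) c)

  p≡indicator : ∀ v X → p[ v ∣ X ] ≡ indicator (lookup (cl X) v)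
  -- At the start every active vertex is new, so the second half of the invariant holds vacuously.
  p≡indicator v X with run-concentrated order {X} {X} (id , λ u∈ u∉ → contradiction u∈ u∉)
  ... | N , c = trans (Pr≡𝔼 (λ s → v ∈? State.active s) (final X))
    (trans (c (λ s → indicator (does (v ∈? State.active s)))) (cong indicator (does-∈? v (cl X))))

  cost≡ : ∀ A X → cost A X ≡ fromℕℚ ∣ A △ cl X ∣
  cost≡ A X = trans (sym (∑-distrib-+ missed activated)) (trans (sum-cong-≗ pointwise) (sum-indicator (A △ cl X)))
    where
    missed activated : V → ℚ
    missed v    = if lookup A v then 1ℚ ℚ.- p[ v ∣ X ] else 0ℚ
    activated v = if lookup (∁ A) v then p[ v ∣ X ] else 0ℚ
    cases : ∀ a s → (if a then 1ℚ ℚ.- indicator s else 0ℚ) ℚ.+ (if not a then indicator s else 0ℚ)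
                      ≡ indicator (a xor s)
    cases true  true  = refl
    cases true  false = refl
    cases false true  = refl
    cases false false = refl
    pointwise : ∀ v → missed v ℚ.+ activated v ≡ indicator (lookup (A △ cl X) v)
    pointwise v rewrite p≡indicator v X | Vec.lookup-map v not A | Vec.lookup-zipWith _xor_ v A (cl X) =
      cases (lookup A v) (lookup (cl X) v)

-- Correctness of the search

-- Cross multiplication by the denominator of `q`. A negative numerator fails because the left-hand
-- side is a natural number.
withinBound⇔≤ : ∀ q c w → ℕᵇ.toℕ w ≡ c * ℚ.↧ₙ q → T (withinBound (ℚ.↥ q) w) ⇔ fromℕℚ c ℚ.≤ q
withinBound⇔≤ q@(ℚ.mkℚ (+ m) d-1 _) c w w≡ = mk⇔
  (λ p → ℚ.*≤* (subst (ℤ._≤ + m ℤ.* + 1) (ℤ.pos-* c (suc d-1))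
    (subst (+ (c * suc d-1) ℤ.≤_) (sym (ℤ.*-identityʳ (+ m)))
      (ℤ.+≤+ (≤-trans (≤-reflexive (sym w≡))
        (≤-trans (Equivalence.to (leᵇ⇔≤ w (fromℕ m)) p) (≤-reflexive (ℕᵇ.toℕ-fromℕ m))))))))
  (λ { (ℚ.*≤* p) → Equivalence.from (leᵇ⇔≤ w (fromℕ m))
    (≤-trans (≤-reflexive w≡) (≤-trans
      (ℤ.drop‿+≤+ (subst (+ (c * suc d-1) ℤ.≤_) (ℤ.*-identityʳ (+ m))
        (subst (ℤ._≤ + m ℤ.* + 1) (sym (ℤ.pos-* c (suc d-1))) p)))
      (≤-reflexive (sym (ℕᵇ.toℕ-fromℕ m))))) })
withinBound⇔≤ (ℚ.mkℚ -[1+ m ] d-1 _) c w w≡ = mk⇔ (λ ())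
  (λ { (ℚ.*≤* p) → neg (subst (ℤ._≤ -[1+ m ] ℤ.* + 1) (sym (ℤ.pos-* c (suc d-1))) p) })
  where
  neg : ¬ (+ (c * suc d-1) ℤ.≤ -[1+ m ] ℤ.* + 1)
  neg ()

module Correctness (I : Instance) (r≡0 : Deterministic I) where
  open Instance I
  open InfluenceGraph graph using (order)
  open Cascade graph using (cost)
  open Reachability (matrix graph)
  open DeterministicCascade graph r≡0 using (cost≡)

  Solution : Subset order → Set
  Solution X = ∣ X ∣ ≤ budget × cost targets X ℚ.≤ bound

  checks : Subset order → Bool
  checks = check (matrix graph) targets (fromℕ budget) (ℚ.↥ bound) (fromℕ (ℚ.↧ₙ bound))

  improve : ∀ {X Y} → ∣ Y ∣ ≤ ∣ X ∣ → ∣ targets △ cl Y ∣ ≤ ∣ targets △ cl X ∣ → Solution X → Solution Y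
  improve {X} {Y} ∣Y∣≤ cost≤ (≤b , ≤c) =
    ≤-trans ∣Y∣≤ ≤b , subst (ℚ._≤ bound) (sym (cost≡ targets Y))
      (ℚ.≤-trans (ℚ.*≤* (ℤ.*-monoʳ-≤-nonNeg (+ 1) (ℤ.+≤+ cost≤))) (subst (ℚ._≤ bound) (cost≡ targets X) ≤c))

  private
    total-budget : ∀ (X : Subset order) → ℕᵇ.toℕ (total X 1+[2 zero ]) ≡ ∣ X ∣
    total-budget X = trans (toℕ-total X _) (*-identityʳ ∣ X ∣)

    total-cost : ∀ (S : Subset order) → ℕᵇ.toℕ (total S (fromℕ (ℚ.↧ₙ bound))) ≡ ∣ S ∣ * ℚ.↧ₙ bound
    total-cost S = trans (toℕ-total S _) (cong (∣ S ∣ *_) (ℕᵇ.toℕ-fromℕ (ℚ.↧ₙ bound)))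

    within : ∀ X → T (withinBound (ℚ.↥ bound) (total (targets △ cl X) (fromℕ (ℚ.↧ₙ bound))))
                     ⇔ fromℕℚ ∣ targets △ cl X ∣ ℚ.≤ bound
    within X = withinBound⇔≤ bound _ _ (total-cost (targets △ cl X))

  checks-sound : ∀ X → T (checks X) → Solution X
  checks-sound X p with leᵇ (total X 1+[2 zero ]) (fromℕ budget) in eq
  ... | true = ≤b , subst (ℚ._≤ bound) (sym (cost≡ targets X)) (Equivalence.to (within X) p)
    where
    ≤b : ∣ X ∣ ≤ budget
    ≤b = ≤-trans (≤-reflexive (sym (total-budget X)))
      (≤-trans (Equivalence.to (leᵇ⇔≤ (total X 1+[2 zero ]) (fromℕ budget)) (Equivalence.from T-≡ eq))
        (≤-reflexive (ℕᵇ.toℕ-fromℕ budget)))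

  checks-complete : ∀ X → Solution X → T (checks X)
  checks-complete X (≤b , ≤c)
    rewrite leᵇ-true (total X 1+[2 zero ]) (fromℕ budget)
      (≤-trans (≤-reflexive (total-budget X)) (≤-trans ≤b (≤-reflexive (sym (ℕᵇ.toℕ-fromℕ budget)))))
    = Equivalence.from (within X) (subst (ℚ._≤ bound) (cost≡ targets X) ≤c)

  decide-sound : ∀ k → T (decide I k) → Effectors I
  decide-sound k p with search-sound (accepts I) order k _ [] p
  ... | D , q with if-true⁻ {checks D} q
  ...   | inj₁ r = D , checks-sound D r
  ...   | inj₂ r = _ , checks-sound _ r

  decide-candidate : ∀ k X → ∣ X ∣ ≤ k → Solution X → T (decide I k)
  decide-candidate k X ≤k s = search-finds (accepts I) k X _ ≤k (if-true⁺ (inj₁ (checks-complete X s)))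

  complete-budget : Effectors I → T (decide I budget)
  complete-budget (X , s) = decide-candidate budget X (proj₁ s) s

  complete-targets : Effectors I → T (decide I ∣ targets ∣)
  complete-targets (X , s) with select (targets ∩ cl X) X (λ v x → v ∈ cl ⁅ x ⁆)
                                  (cl-point ∘ proj₂ ∘ x∈p∩q⁻ targets (cl X))
  ... | Y , Y⊆X , ∣Y∣≤ , covers = decide-candidate ∣ targets ∣ Y
      (≤-trans ∣Y∣≤ (∣p∩q∣≤∣p∣ targets (cl X)))
      (improve (p⊆q⇒∣p∣≤∣q∣ Y⊆X) (p⊆q⇒∣p∣≤∣q∣ fewer) s)
    where
    -- Fewer effectors activate no further non-target, and each target that `X` activates keeps an
    -- effector in `Y`.
    fewer : targets △ cl Y ⊆ targets △ cl X
    fewer p with △⁻ targets (cl Y) p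
    ... | inj₂ (∉A , ∈Y) = △⁺ʳ ∉A (cl-mono Y⊆X ∈Y)
    ... | inj₁ (∈A , ∉Y) = △⁺ˡ ∈A λ ∈X → ∉Y (covered (covers (x∈p∩q⁺ (∈A , ∈X))))
      where
      covered : ∀ {v} → ∃[ x ] x ∈ Y × v ∈ cl ⁅ x ⁆ → v ∈ cl Y
      covered (x , x∈Y , v∈) = cl-mono (λ q → subst (_∈ Y) (sym (x∈⁅y⁆⇒x≡y x q)) x∈Y) v∈

  complete-cost : ∀ c → bound ≡ + c ℚ./ 1 → Effectors I → T (decide I c)
  complete-cost c bound≡ (X , s) = search-finds (accepts I) c D _ ∣D∣≤c
    (if-true⁺ {checks D} (inj₂ (checks-complete Y′ (subst Solution (sym Y′≡Y) solution))))
    where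
    D Y Y′ : Subset order
    D  = targets △ cl X
    Y  = prune (matrix graph) order (cl X)
    Y′ = prune (matrix graph) order (targets △ D)
    Y′≡Y : Y′ ≡ Y
    Y′≡Y = cong (prune (matrix graph) order) (△-involutive targets (cl X))
    ∣D∣≤c : ∣ D ∣ ≤ c
    ∣D∣≤c with subst (fromℕℚ ∣ D ∣ ℚ.≤_) (trans bound≡ (ℚ.↥p/↧p≡p (fromℕℚ c)))
                 (subst (ℚ._≤ bound) (cost≡ targets X) (proj₂ s))
    ... | ℚ.*≤* p = ℤ.drop‿+≤+ (ℤ.*-cancelʳ-≤-pos _ _ (+ 1) p)
    cl-Y : cl Y ≡ cl X
    cl-Y = ⊆-antisym (cl-minimal (prune⊆ order))
                     (cl-minimal (λ p → prune-generates order (cl-extensive p)))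
    solution : Solution Y
    -- Equal closures give equal costs, and minimality of `Y` among generating sets keeps it within
    -- the budget that `X` meets.
    solution = improve (prune-minimum X) (≤-reflexive (cong (λ S → ∣ targets △ S ∣) cl-Y)) s

-- The three parameterizations

search-XP : ∀ {K} → (∀ f → expSize (body f) ≤ K) → (Π : ParameterizedProblem) →
  let open ParameterizedProblem Π in
  (inst : Input → Instance) → (∀ x → encode x ≡ encInstance (inst x)) →
  (∀ x → T (decide (inst x) (parameter x)) → Yes x) → (∀ x → Yes x → T (decide (inst x) (parameter x))) →
  XP Π
search-XP {K} body-size Π inst enc≡ sound complete =
  program searchMain , (λ k → degree K + k) , Running.add-computable body-size (degree K) , λ x →
    -- This decision has `decide` as its Boolean by computation, so the output of the program is
    -- already the required encoding.
    map′ (sound x) (complete x) (T? (decide (inst x) (parameter x))) ,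
    subst (λ e → ∃[ t ] t ≤ size e ^ (degree K + parameter x) ×
        program searchMain [ e ∙ encℕ (parameter x) ]⇓ encBool (decide (inst x) (parameter x)) ⟨ t ⟩)
      (sym (enc≡ x)) (Running.decide-time body-size (inst x) (parameter x))
  where open ParameterizedProblem Π

-- 64 is a round number above the size of the largest body, that of `searchF`; it affects only the
-- fixed part of the exponent.
body-size : ∀ f → expSize (body f) ≤ 64
body-size = from-yes (Fin.all? λ f → expSize (body f) ≤? 64)

proposition1 : XP Effectors-by-targets × XP Effectors-by-budget × XP Effectors-by-cost
proposition1 =
  search-XP body-size Effectors-by-targets proj₁ (λ _ → refl)
    (λ (I , r≡0) → Correctness.decide-sound I r≡0 ∣ Instance.targets I ∣)
    (λ (I , r≡0) → Correctness.complete-targets I r≡0) ,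
  search-XP body-size Effectors-by-budget proj₁ (λ _ → refl)
    (λ (I , r≡0) → Correctness.decide-sound I r≡0 (Instance.budget I))
    (λ (I , r≡0) → Correctness.complete-budget I r≡0) ,
  search-XP body-size Effectors-by-cost proj₁ (λ _ → refl)
    (λ (I , r≡0 , c , _) → Correctness.decide-sound I r≡0 c)
    (λ (I , r≡0 , c , bound≡) → Correctness.complete-cost I r≡0 c bound≡)
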